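{- Assume $c\ge 1$, $n$ is large enough and $\gamma\le 1/4$. Any (possibly randomized) algorithm in the noisy model with parameter $\gamma$ with query complexity $\frac{cn}{\gamma^2}$ solves FINDMIN on $n$ elements with probability at most $1-e^{ -O(c)}$.
   Context: Setting. The input is a set of $n$ elements with an unknown total order, presented in uniformly random order (the elements are a priori indistinguishable). FINDMIN: output the minimum element. Algorithms access the order only through pairwise comparison queries, which may be made adaptively in any number of rounds and with repetition (resampling). Query complexity is the total number of comparisons. Noisy model with parameter $\gamma$: each comparison independently returns the correct answer with probability $1/2+\gamma/2$ and the incorrect answer with probability $1/2-\gamma/2$. The success probability is over the random input order, the comparison outcomes and the algorithm's randomness. -}

module Defs where

open import Data.Bool using (Bool; not; if_then_else_)
open import Data.Fin using (Fin; zero; suc)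
import Data.Fin as Fin
import Data.Fin.Properties as Finₚ
open import Data.Fin.Permutation using (Permutation′; _⟨$⟩ʳ_; _≈_; insert; remove; insert-remove; insert-punchIn; id)
open import Data.Integer using (+_)
import Data.Integer as ℤ
import Data.Integer.Properties as ℤₚ
open import Data.List using (List; []; _∷_; map; foldr; cartesianProductWith; allFin; length)
import Data.List.Properties as Listₚ
open import Data.List.Relation.Unary.Any using (Any; here)
import Data.List.Relation.Unary.Any.Properties as Anyₚ
open import Data.List.Membership.Propositional.Properties using (∈-allFin)
open import Data.Nat using (ℕ; zero; suc; _!)
import Data.Nat as ℕ
import Data.Nat.Properties as ℕₚ
open import Data.Product using (∃; _×_; _,_)
open import Data.Rational using (ℚ; 0ℚ; 1ℚ; ½; _/_; ∣_∣)
import Data.Rational as ℚ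
import Data.Rational.Properties as ℚₚ
import Data.Rational.Unnormalised as ℚᵘ
import Data.Rational.Unnormalised.Properties as ℚᵘₚ
open import Data.Rational.Solver using (module +-*-Solver)
open import Relation.Binary.PropositionalEquality using (_≡_; _≢_; refl; sym; trans; cong; cong₂; subst)
open import Relation.Nullary using (Dec; does)

module ℚ-Lemmas where

  ℚ-pos : ∀ n → 0ℚ ℚ.< (+ 1 / suc n)
  ℚ-pos n = ℚₚ.positive⁻¹ (+ 1 / suc n) {{ℚₚ.normalize-pos 1 (suc n)}}

  nn : ∀ {p} → 0ℚ ℚ.≤ p → ℚ.NonNegative p
  nn = ℚ.nonNegative

  *-nonneg : ∀ {p q} → 0ℚ ℚ.≤ p → 0ℚ ℚ.≤ q → 0ℚ ℚ.≤ p ℚ.* q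
  *-nonneg {p} {q} hp hq =
    subst (ℚ._≤ p ℚ.* q) (ℚₚ.*-zeroʳ p) (ℚₚ.*-monoˡ-≤-nonNeg p {{nn hp}} hq)

  *-mono : ∀ {p p′ q q′} → 0ℚ ℚ.≤ p → 0ℚ ℚ.≤ q′ →
           p ℚ.≤ p′ → q ℚ.≤ q′ → p ℚ.* q ℚ.≤ p′ ℚ.* q′
  *-mono {p} {p′} {q} {q′} hp hq′ h k =
    ℚₚ.≤-trans (ℚₚ.*-monoˡ-≤-nonNeg p {{nn hp}} k) (ℚₚ.*-monoʳ-≤-nonNeg q′ {{nn hq′}} h)

  *-pos : ∀ {p q} → 0ℚ ℚ.< p → 0ℚ ℚ.< q → 0ℚ ℚ.< p ℚ.* q
  *-pos {p} {q} hp hq =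
    subst (ℚ._< p ℚ.* q) (ℚₚ.*-zeroʳ p) (ℚₚ.*-monoʳ-<-pos p {{ℚ.positive hp}} hq)

  halves : ∀ ε → ε ℚ.* ½ ℚ.+ ε ℚ.* ½ ≡ ε
  halves ε = trans (sym (ℚₚ.*-distribˡ-+ ε ½ ½)) (ℚₚ.*-identityʳ ε)

  half-pos : ∀ {ε} → 0ℚ ℚ.< ε → 0ℚ ℚ.< ε ℚ.* ½
  half-pos h = *-pos h (ℚₚ.positive⁻¹ ½)

  fromℕ-inv : ∀ k → (+ suc k / 1) ℚ.* (+ 1 / suc k) ≡ 1ℚ
  fromℕ-inv k = ℚₚ.toℚᵘ-injective (begin
    ℚ.toℚᵘ ((+ suc k / 1) ℚ.* (+ 1 / suc k))           ≈⟨ ℚₚ.toℚᵘ-homo-* (+ suc k / 1) (+ 1 / suc k) ⟩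
    ℚ.toℚᵘ (+ suc k / 1) ℚᵘ.* ℚ.toℚᵘ (+ 1 / suc k)     ≈⟨ ℚᵘₚ.*-cong (ℚₚ.toℚᵘ-fromℚᵘ (ℚᵘ.mkℚᵘ (+ suc k) 0)) (ℚₚ.toℚᵘ-fromℚᵘ (ℚᵘ.mkℚᵘ (+ 1) k)) ⟩
    ℚᵘ.mkℚᵘ (+ suc k) 0 ℚᵘ.* ℚᵘ.mkℚᵘ (+ 1) k           ≈⟨ ℚᵘ.*≡* (trans (ℤₚ.*-identityʳ _) (trans (ℤₚ.*-identityʳ _) (sym (trans (ℤₚ.*-identityˡ _) (ℤₚ.*-identityˡ (+ suc k)))))) ⟩
    ℚ.toℚᵘ 1ℚ ∎)
    where open ℚᵘₚ.≃-Reasoning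

  archimedes : ∀ p → ∃ λ k → p ℚ.≤ + suc k / 1
  archimedes p@(ℚ.mkℚ n d-1 _) = ℤ.∣ n ∣ , ℚₚ.toℚᵘ-cancel-≤
      (ℚᵘₚ.≤-trans (ℚᵘ.*≤* ineq) (ℚᵘₚ.≤-reflexive (ℚᵘₚ.≃-sym (ℚₚ.toℚᵘ-fromℚᵘ (ℚᵘ.mkℚᵘ (+ suc ℤ.∣ n ∣) 0)))))
    where
    abs≤ : ∀ i → i ℤ.≤ + ℤ.∣ i ∣
    abs≤ (+ m) = ℤₚ.≤-refl
    abs≤ (ℤ.-[1+ m ]) = ℤ.-≤+
    ineq : n ℤ.* + 1 ℤ.≤ + suc ℤ.∣ n ∣ ℤ.* + suc d-1
    ineq = ℤₚ.≤-trans (ℤₚ.≤-reflexive (ℤₚ.*-identityʳ n))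
          (ℤₚ.≤-trans (abs≤ n) (ℤ.+≤+ (ℕₚ.≤-trans (ℕₚ.n≤1+n _) (ℕₚ.m≤m*n (suc ℤ.∣ n ∣) (suc d-1)))))

  fromℕ-mono : ∀ {k l} → k ℕ.≤ l → (+ k / 1) ℚ.≤ (+ l / 1)
  fromℕ-mono {k} {l} h = ℚₚ.toℚᵘ-cancel-≤ (ℚᵘₚ.≤-respˡ-≃ (ℚᵘₚ.≃-sym (ℚₚ.toℚᵘ-fromℚᵘ (ℚᵘ.mkℚᵘ (+ k) 0)))
     (ℚᵘₚ.≤-respʳ-≃ (ℚᵘₚ.≃-sym (ℚₚ.toℚᵘ-fromℚᵘ (ℚᵘ.mkℚᵘ (+ l) 0)))
       (ℚᵘ.*≤* (ℤₚ.*-monoʳ-≤-nonNeg (+ 1) (ℤ.+≤+ h)))))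

  0≤fromℕ : ∀ k → 0ℚ ℚ.≤ (+ k / 1)
  0≤fromℕ k = fromℕ-mono {0} {k} ℕ.z≤n

  triangle : ∀ a b c → ∣ a ℚ.- c ∣ ℚ.≤ ∣ a ℚ.- b ∣ ℚ.+ ∣ b ℚ.- c ∣
  triangle a b c = subst (λ z → ∣ z ∣ ℚ.≤ ∣ a ℚ.- b ∣ ℚ.+ ∣ b ℚ.- c ∣)
    (solve 3 (λ x y z → (x :- y) :+ (y :- z) := x :- z) refl a b c)
    (ℚₚ.∣p+q∣≤∣p∣+∣q∣ (a ℚ.- b) (b ℚ.- c))
    where open +-*-Solver

  ∣-∣-sym : ∀ a b → ∣ a ℚ.- b ∣ ≡ ∣ b ℚ.- a ∣
  ∣-∣-sym a b = trans (cong ∣_∣ (solve 2 (λ x y → x :- y := :- (y :- x)) refl a b)) (ℚₚ.∣-p∣≡∣p∣ (b ℚ.- a))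
    where open +-*-Solver

open ℚ-Lemmas

-- Real numbers, as Cauchy sequences of rationals.  Distinct sequences may
-- denote the same real; equality of reals is _≃_ below.

Cauchy : (ℕ → ℚ) → Set
Cauchy s = ∀ ε → 0ℚ ℚ.< ε → ∃ λ N → ∀ m n → N ℕ.≤ m → N ℕ.≤ n → ∣ s m ℚ.- s n ∣ ℚ.≤ ε

record ℝ : Set where
  constructor mkℝ
  field
    seq    : ℕ → ℚ
    cauchy : Cauchy seq

open ℝ public

infix 4 _≤_ _<_ _≃_

_≤_ : ℝ → ℝ → Set
x ≤ y = ∀ ε → 0ℚ ℚ.< ε → ∃ λ N → ∀ n → N ℕ.≤ n → seq x n ℚ.≤ seq y n ℚ.+ ε

_<_ : ℝ → ℝ → Set
x < y = ∃ λ ε → 0ℚ ℚ.< ε × (∃ λ N → ∀ n → N ℕ.≤ n → seq x n ℚ.+ ε ℚ.≤ seq y n)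

_≃_ : ℝ → ℝ → Set
x ≃ y = (x ≤ y) × (y ≤ x)

module Cauchy-Lemmas where

  abstract
    const-cauchy : ∀ p → Cauchy (λ _ → p)
    const-cauchy p ε ε>0 = 0 , λ _ _ _ _ →
      subst (λ z → ∣ z ∣ ℚ.≤ ε) (sym (ℚₚ.+-inverseʳ p)) (ℚₚ.<⇒≤ ε>0)

  abstract
    +-cauchy : ∀ {s t} → Cauchy s → Cauchy t → Cauchy (λ n → s n ℚ.+ t n)
    +-cauchy {s} {t} cs ct ε ε>0
      with cs (ε ℚ.* ½) (half-pos ε>0) | ct (ε ℚ.* ½) (half-pos ε>0)
    ... | N , hs | M , ht = N ℕ.⊔ M , λ m n m≥ n≥ →
        let open ℚₚ.≤-Reasoning in begin
        ∣ (s m ℚ.+ t m) ℚ.- (s n ℚ.+ t n) ∣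
          ≡⟨ cong ∣_∣ (rearr (s m) (t m) (s n) (t n)) ⟩
        ∣ (s m ℚ.- s n) ℚ.+ (t m ℚ.- t n) ∣
          ≤⟨ ℚₚ.∣p+q∣≤∣p∣+∣q∣ (s m ℚ.- s n) (t m ℚ.- t n) ⟩
        ∣ s m ℚ.- s n ∣ ℚ.+ ∣ t m ℚ.- t n ∣
          ≤⟨ ℚₚ.+-mono-≤ (hs m n (ℕₚ.m⊔n≤o⇒m≤o N M m≥) (ℕₚ.m⊔n≤o⇒m≤o N M n≥)) (ht m n (ℕₚ.m⊔n≤o⇒n≤o N M m≥) (ℕₚ.m⊔n≤o⇒n≤o N M n≥)) ⟩
        ε ℚ.* ½ ℚ.+ ε ℚ.* ½
          ≡⟨ halves ε ⟩
        ε ∎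
      where
      rearr : ∀ a b c d → (a ℚ.+ b) ℚ.- (c ℚ.+ d) ≡ (a ℚ.- c) ℚ.+ (b ℚ.- d)
      rearr = solve 4 (λ a b c d → (a :+ b) :- (c :+ d) := (a :- c) :+ (b :- d)) refl
        where open +-*-Solver

  abstract
    neg-cauchy : ∀ {s} → Cauchy s → Cauchy (λ n → ℚ.- s n)
    neg-cauchy {s} cs ε ε>0 with cs ε ε>0
    ... | N , hs = N , λ m n m≥ n≥ →
        subst (ℚ._≤ ε) (trans (sym (ℚₚ.∣-p∣≡∣p∣ (s m ℚ.- s n))) (cong ∣_∣ (rearr (s m) (s n)))) (hs m n m≥ n≥)
      where
      rearr : ∀ a b → ℚ.- (a ℚ.- b) ≡ ℚ.- a ℚ.- (ℚ.- b)
      rearr = solve 2 (λ a b → :- (a :- b) := :- a :- (:- b)) refl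
        where open +-*-Solver

  EventuallyBounded : (ℕ → ℚ) → Set
  EventuallyBounded s = ∃ λ k → ∃ λ N → ∀ n → N ℕ.≤ n → ∣ s n ∣ ℚ.≤ + suc k / 1

  cauchy⇒bounded : ∀ {s} → Cauchy s → EventuallyBounded s
  cauchy⇒bounded {s} cs with cs 1ℚ (ℚₚ.positive⁻¹ 1ℚ)
  ... | N , hs with archimedes (1ℚ ℚ.+ ∣ s N ∣)
  ... | k , hk = k , N , λ n n≥ → let open ℚₚ.≤-Reasoning in begin
      ∣ s n ∣                         ≡⟨ cong ∣_∣ (rearr (s n) (s N)) ⟩
      ∣ (s n ℚ.- s N) ℚ.+ s N ∣       ≤⟨ ℚₚ.∣p+q∣≤∣p∣+∣q∣ (s n ℚ.- s N) (s N) ⟩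
      ∣ s n ℚ.- s N ∣ ℚ.+ ∣ s N ∣     ≤⟨ ℚₚ.+-monoˡ-≤ ∣ s N ∣ (hs n N n≥ ℕₚ.≤-refl) ⟩
      1ℚ ℚ.+ ∣ s N ∣                  ≤⟨ hk ⟩
      + suc k / 1 ∎
    where
    rearr : ∀ a b → a ≡ (a ℚ.- b) ℚ.+ b
    rearr = solve 2 (λ a b → a := (a :- b) :+ b) refl
      where open +-*-Solver

  private
    piece : ∀ {a d η r R} → R ℚ.* r ≡ 1ℚ → ∣ a ∣ ℚ.≤ R → ∣ d ∣ ℚ.≤ η ℚ.* r → ∣ a ℚ.* d ∣ ℚ.≤ η
    piece {a} {d} {η} {r} {R} Rr ha hd = begin
      ∣ a ℚ.* d ∣        ≡⟨ ℚₚ.∣p*q∣≡∣p∣*∣q∣ a d ⟩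
      ∣ a ∣ ℚ.* ∣ d ∣    ≤⟨ *-mono (ℚₚ.0≤∣p∣ a) (ℚₚ.≤-trans (ℚₚ.0≤∣p∣ d) hd) ha hd ⟩
      R ℚ.* (η ℚ.* r)    ≡⟨ swap R η r ⟩
      η ℚ.* (R ℚ.* r)    ≡⟨ cong (η ℚ.*_) Rr ⟩
      η ℚ.* 1ℚ           ≡⟨ ℚₚ.*-identityʳ η ⟩
      η ∎
      where
      open ℚₚ.≤-Reasoning
      swap : ∀ x y z → x ℚ.* (y ℚ.* z) ≡ y ℚ.* (x ℚ.* z)
      swap = solve 3 (λ x y z → x :* (y :* z) := y :* (x :* z)) refl
        where open +-*-Solver

    close : ∀ {a b c d η} → ∣ a ℚ.* (b ℚ.- d) ∣ ℚ.≤ η → ∣ d ℚ.* (a ℚ.- c) ∣ ℚ.≤ η →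
            ∣ a ℚ.* b ℚ.- c ℚ.* d ∣ ℚ.≤ η ℚ.+ η
    close {a} {b} {c} {d} {η} h k = begin
      ∣ a ℚ.* b ℚ.- c ℚ.* d ∣                                  ≡⟨ cong ∣_∣ (rearr a b c d) ⟩
      ∣ a ℚ.* (b ℚ.- d) ℚ.+ d ℚ.* (a ℚ.- c) ∣                  ≤⟨ ℚₚ.∣p+q∣≤∣p∣+∣q∣ (a ℚ.* (b ℚ.- d)) (d ℚ.* (a ℚ.- c)) ⟩
      ∣ a ℚ.* (b ℚ.- d) ∣ ℚ.+ ∣ d ℚ.* (a ℚ.- c) ∣              ≤⟨ ℚₚ.+-mono-≤ h k ⟩
      η ℚ.+ η ∎
      where
      open ℚₚ.≤-Reasoning
      rearr : ∀ a b c d → a ℚ.* b ℚ.- c ℚ.* d ≡ a ℚ.* (b ℚ.- d) ℚ.+ d ℚ.* (a ℚ.- c)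
      rearr = solve 4 (λ a b c d → a :* b :- c :* d := a :* (b :- d) :+ d :* (a :- c)) refl
        where open +-*-Solver

    *-cauchy′ : ∀ {s t : ℕ → ℚ} {ε R r L l N₁ N₂} → R ℚ.* r ≡ 1ℚ → L ℚ.* l ≡ 1ℚ →
      (∀ n → N₁ ℕ.≤ n → ∣ s n ∣ ℚ.≤ R) → (∀ n → N₂ ℕ.≤ n → ∣ t n ∣ ℚ.≤ L) →
      (∃ λ N → ∀ m n → N ℕ.≤ m → N ℕ.≤ n → ∣ s m ℚ.- s n ∣ ℚ.≤ ε ℚ.* ½ ℚ.* l) →
      (∃ λ N → ∀ m n → N ℕ.≤ m → N ℕ.≤ n → ∣ t m ℚ.- t n ∣ ℚ.≤ ε ℚ.* ½ ℚ.* r) →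
      ∃ λ N → ∀ m n → N ℕ.≤ m → N ℕ.≤ n → ∣ s m ℚ.* t m ℚ.- s n ℚ.* t n ∣ ℚ.≤ ε
    *-cauchy′ {s} {t} {ε} {R} {r} {L} {l} {N₁} {N₂} Rr Ll bs bt (N₃ , hs) (N₄ , ht) =
      (N₁ ℕ.⊔ N₂) ℕ.⊔ (N₃ ℕ.⊔ N₄) , λ m n m≥ n≥ →
        subst (∣ s m ℚ.* t m ℚ.- s n ℚ.* t n ∣ ℚ.≤_) (halves ε)
          (close {s m} {t m} {s n} {t n}
            (piece {s m} {t m ℚ.- t n} {ε ℚ.* ½} Rr (bs m (p₁ m≥)) (ht m n (p₄ m≥) (p₄ n≥)))
            (piece {t n} {s m ℚ.- s n} {ε ℚ.* ½} Ll (bt n (p₂ n≥)) (hs m n (p₃ m≥) (p₃ n≥))))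
      where
      p₁ : ∀ {m} → (N₁ ℕ.⊔ N₂) ℕ.⊔ (N₃ ℕ.⊔ N₄) ℕ.≤ m → N₁ ℕ.≤ m
      p₁ h = ℕₚ.m⊔n≤o⇒m≤o N₁ N₂ (ℕₚ.m⊔n≤o⇒m≤o (N₁ ℕ.⊔ N₂) (N₃ ℕ.⊔ N₄) h)
      p₂ : ∀ {m} → (N₁ ℕ.⊔ N₂) ℕ.⊔ (N₃ ℕ.⊔ N₄) ℕ.≤ m → N₂ ℕ.≤ m
      p₂ h = ℕₚ.m⊔n≤o⇒n≤o N₁ N₂ (ℕₚ.m⊔n≤o⇒m≤o (N₁ ℕ.⊔ N₂) (N₃ ℕ.⊔ N₄) h)
      p₃ : ∀ {m} → (N₁ ℕ.⊔ N₂) ℕ.⊔ (N₃ ℕ.⊔ N₄) ℕ.≤ m → N₃ ℕ.≤ m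
      p₃ h = ℕₚ.m⊔n≤o⇒m≤o N₃ N₄ (ℕₚ.m⊔n≤o⇒n≤o (N₁ ℕ.⊔ N₂) (N₃ ℕ.⊔ N₄) h)
      p₄ : ∀ {m} → (N₁ ℕ.⊔ N₂) ℕ.⊔ (N₃ ℕ.⊔ N₄) ℕ.≤ m → N₄ ℕ.≤ m
      p₄ h = ℕₚ.m⊔n≤o⇒n≤o N₃ N₄ (ℕₚ.m⊔n≤o⇒n≤o (N₁ ℕ.⊔ N₂) (N₃ ℕ.⊔ N₄) h)

  abstract
    *-cauchy : ∀ {s t} → Cauchy s → Cauchy t → Cauchy (λ n → s n ℚ.* t n)
    *-cauchy {s} {t} cs ct ε ε>0 = go (cauchy⇒bounded {s} cs) (cauchy⇒bounded {t} ct)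
      where
      go : EventuallyBounded s → EventuallyBounded t →
           ∃ λ N → ∀ m n → N ℕ.≤ m → N ℕ.≤ n → ∣ s m ℚ.* t m ℚ.- s n ℚ.* t n ∣ ℚ.≤ ε
      go (k , N₁ , bs) (l , N₂ , bt) =
        *-cauchy′ {s} {t} {ε} {+ suc k / 1} {+ 1 / suc k} {+ suc l / 1} {+ 1 / suc l} {N₁} {N₂}
          (fromℕ-inv k) (fromℕ-inv l) bs bt
          (cs (ε ℚ.* ½ ℚ.* (+ 1 / suc l)) (*-pos (half-pos ε>0) (ℚ-pos l)))
          (ct (ε ℚ.* ½ ℚ.* (+ 1 / suc k)) (*-pos (half-pos ε>0) (ℚ-pos k)))

open Cauchy-Lemmas

infixl 6 _+_ _-_
infixl 7 _*_
infix  8 -_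

fromℚ : ℚ → ℝ
fromℚ p = mkℝ (λ _ → p) (const-cauchy p)

fromℕ : ℕ → ℝ
fromℕ n = fromℚ (+ n / 1)

0ℝ 1ℝ : ℝ
0ℝ = fromℚ 0ℚ
1ℝ = fromℚ 1ℚ

_+_ : ℝ → ℝ → ℝ
x + y = mkℝ (λ n → seq x n ℚ.+ seq y n) (+-cauchy {seq x} {seq y} (cauchy x) (cauchy y))

_*_ : ℝ → ℝ → ℝ
x * y = mkℝ (λ n → seq x n ℚ.* seq y n) (*-cauchy {seq x} {seq y} (cauchy x) (cauchy y))

-_ : ℝ → ℝ
- x = mkℝ (λ n → ℚ.- seq x n) (neg-cauchy {seq x} (cauchy x))

_-_ : ℝ → ℝ → ℝ
x - y = x + (- y)

∑ : ∀ {A : Set} → List A → (A → ℝ) → ℝ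
∑ xs f = foldr (λ x s → f x + s) 0ℝ xs

-- expTerm k a = aᵏ / k!
expTerm : ℕ → ℚ → ℚ
expTerm zero    a = 1ℚ
expTerm (suc k) a = expTerm k a ℚ.* (a ℚ.* (+ 1 / suc k))

-- expSum n a = Σ_{k<n} aᵏ / k!
expSum : ℕ → ℚ → ℚ
expSum zero    a = 0ℚ
expSum (suc n) a = expSum n a ℚ.+ expTerm n a

module Exp-Lemmas where

  expTerm-cauchy : ∀ k {s} → Cauchy s → Cauchy (λ n → expTerm k (s n))
  expTerm-cauchy zero        cs = const-cauchy 1ℚ
  expTerm-cauchy (suc k) {s} cs =
    *-cauchy {λ n → expTerm k (s n)} {λ n → s n ℚ.* (+ 1 / suc k)} (expTerm-cauchy k {s} cs)
      (*-cauchy {s} {λ _ → + 1 / suc k} cs (const-cauchy (+ 1 / suc k)))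

  expSum-cauchy : ∀ k {s} → Cauchy s → Cauchy (λ n → expSum k (s n))
  expSum-cauchy zero        cs = const-cauchy 0ℚ
  expSum-cauchy (suc k) {s} cs =
    +-cauchy {λ n → expSum k (s n)} {λ n → expTerm k (s n)} (expSum-cauchy k {s} cs) (expTerm-cauchy k {s} cs)

  expTerm-nonneg : ∀ k {b} → 0ℚ ℚ.≤ b → 0ℚ ℚ.≤ expTerm k b
  expTerm-nonneg zero    h = ℚₚ.<⇒≤ (ℚₚ.positive⁻¹ 1ℚ)
  expTerm-nonneg (suc k) h = *-nonneg (expTerm-nonneg k h) (*-nonneg h (ℚₚ.<⇒≤ (ℚ-pos k)))

  expTerm-bound : ∀ k {a b} → ∣ a ∣ ℚ.≤ b → ∣ expTerm k a ∣ ℚ.≤ expTerm k b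
  expTerm-bound zero    h = ℚₚ.≤-refl
  expTerm-bound (suc k) {a} {b} h = let open ℚₚ.≤-Reasoning in begin
    ∣ expTerm k a ℚ.* (a ℚ.* r) ∣       ≡⟨ ℚₚ.∣p*q∣≡∣p∣*∣q∣ (expTerm k a) (a ℚ.* r) ⟩
    ∣ expTerm k a ∣ ℚ.* ∣ a ℚ.* r ∣     ≡⟨ cong (∣ expTerm k a ∣ ℚ.*_) (trans (ℚₚ.∣p*q∣≡∣p∣*∣q∣ a r) (cong (∣ a ∣ ℚ.*_) (ℚₚ.0≤p⇒∣p∣≡p r≥0))) ⟩
    ∣ expTerm k a ∣ ℚ.* (∣ a ∣ ℚ.* r)   ≤⟨ *-mono (ℚₚ.0≤∣p∣ (expTerm k a)) (*-nonneg b≥0 r≥0) (expTerm-bound k h) (ℚₚ.*-monoʳ-≤-nonNeg r {{nn r≥0}} h) ⟩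
    expTerm k b ℚ.* (b ℚ.* r) ∎
    where
    r = + 1 / suc k
    r≥0 = ℚₚ.<⇒≤ (ℚ-pos k)
    b≥0 = ℚₚ.≤-trans (ℚₚ.0≤∣p∣ a) h

  pow½ : ℕ → ℚ
  pow½ zero    = 1ℚ
  pow½ (suc i) = pow½ i ℚ.* ½

  pow½-pos : ∀ i → 0ℚ ℚ.< pow½ i
  pow½-pos zero    = ℚₚ.positive⁻¹ 1ℚ
  pow½-pos (suc i) = half-pos (pow½-pos i)

  +1/1 : ∀ i → (+ suc i / 1) ≡ 1ℚ ℚ.+ (+ i / 1)
  +1/1 i = ℚₚ.toℚᵘ-injective (begin
    ℚ.toℚᵘ (+ suc i / 1)                     ≈⟨ ℚₚ.toℚᵘ-fromℚᵘ (ℚᵘ.mkℚᵘ (+ suc i) 0) ⟩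
    ℚᵘ.mkℚᵘ (+ suc i) 0                      ≈⟨ ℚᵘ.*≡* (cong (ℤ._* + 1) (cong (ℤ._+_ (+ 1)) (sym (ℤₚ.*-identityʳ (+ i))))) ⟩
    ℚ.toℚᵘ 1ℚ ℚᵘ.+ ℚᵘ.mkℚᵘ (+ i) 0           ≈⟨ ℚᵘₚ.+-cong ℚᵘₚ.≃-refl (ℚᵘₚ.≃-sym (ℚₚ.toℚᵘ-fromℚᵘ (ℚᵘ.mkℚᵘ (+ i) 0))) ⟩
    ℚ.toℚᵘ 1ℚ ℚᵘ.+ ℚ.toℚᵘ (+ i / 1)          ≈⟨ ℚᵘₚ.≃-sym (ℚₚ.toℚᵘ-homo-+ 1ℚ (+ i / 1)) ⟩
    ℚ.toℚᵘ (1ℚ ℚ.+ (+ i / 1)) ∎)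
    where open ℚᵘₚ.≃-Reasoning

  pow½-bound : ∀ i → (+ i / 1) ℚ.* pow½ i ℚ.≤ 1ℚ
  pow½≤1 : ∀ i → pow½ i ℚ.≤ 1ℚ
  pow½≤1 zero    = ℚₚ.≤-refl
  pow½≤1 (suc i) = ℚₚ.≤-trans (*-mono (ℚₚ.<⇒≤ (pow½-pos i)) (ℚₚ.<⇒≤ (ℚₚ.positive⁻¹ 1ℚ)) (pow½≤1 i) (ℚₚ.≤ᵇ⇒≤ {½} {1ℚ} _)) (ℚₚ.≤-reflexive (ℚₚ.*-identityʳ 1ℚ))
  pow½-bound zero    = ℚₚ.≤ᵇ⇒≤ {0ℚ} {1ℚ} _
  pow½-bound (suc i) = let open ℚₚ.≤-Reasoning in begin
    (+ suc i / 1) ℚ.* (pow½ i ℚ.* ½)                     ≡⟨ cong (ℚ._* (pow½ i ℚ.* ½)) (+1/1 i) ⟩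
    (1ℚ ℚ.+ (+ i / 1)) ℚ.* (pow½ i ℚ.* ½)                ≡⟨ rearr (+ i / 1) (pow½ i) ½ ⟩
    (pow½ i ℚ.+ (+ i / 1) ℚ.* pow½ i) ℚ.* ½              ≤⟨ ℚₚ.*-monoʳ-≤-nonNeg ½ (ℚₚ.+-mono-≤ (pow½≤1 i) (pow½-bound i)) ⟩
    (1ℚ ℚ.+ 1ℚ) ℚ.* ½                                    ≡⟨⟩
    1ℚ ∎
    where
    rearr : ∀ x y h → (1ℚ ℚ.+ x) ℚ.* (y ℚ.* h) ≡ (y ℚ.+ x ℚ.* y) ℚ.* h
    rearr = solve 3 (λ x y h → (con 1ℚ :+ x) :* (y :* h) := (y :+ x :* y) :* h) refl
      where open +-*-Solver

  pow½-small : ∀ T δ → 0ℚ ℚ.≤ T → 0ℚ ℚ.< δ → ∃ λ i → T ℚ.* pow½ i ℚ.≤ δ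
  pow½-small T δ T≥0 δ>0 with archimedes (T ℚ.* ℚ.1/ δ)
    where instance _ = ℚ.>-nonZero δ>0
  ... | k , hk = suc k , (let open ℚₚ.≤-Reasoning in begin
      T ℚ.* pow½ (suc k)                          ≡⟨ cong (ℚ._* pow½ (suc k)) eq ⟩
      δ ℚ.* (T ℚ.* ℚ.1/ δ) ℚ.* pow½ (suc k)       ≤⟨ ℚₚ.*-monoʳ-≤-nonNeg (pow½ (suc k)) {{nn (ℚₚ.<⇒≤ (pow½-pos (suc k)))}} (ℚₚ.*-monoˡ-≤-nonNeg δ {{nn (ℚₚ.<⇒≤ δ>0)}} hk) ⟩
      δ ℚ.* (+ suc k / 1) ℚ.* pow½ (suc k)        ≡⟨ ℚₚ.*-assoc δ (+ suc k / 1) (pow½ (suc k)) ⟩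
      δ ℚ.* ((+ suc k / 1) ℚ.* pow½ (suc k))      ≤⟨ ℚₚ.*-monoˡ-≤-nonNeg δ {{nn (ℚₚ.<⇒≤ δ>0)}} (pow½-bound (suc k)) ⟩
      δ ℚ.* 1ℚ                                    ≡⟨ ℚₚ.*-identityʳ δ ⟩
      δ ∎)
    where
    instance _ = ℚ.>-nonZero δ>0
    swap : ∀ x y z → x ℚ.* (y ℚ.* z) ≡ y ℚ.* (x ℚ.* z)
    swap = solve 3 (λ x y z → x :* (y :* z) := y :* (x :* z)) refl
      where open +-*-Solver
    eq : T ≡ δ ℚ.* (T ℚ.* ℚ.1/ δ)
    eq = sym (trans (swap δ T (ℚ.1/ δ)) (trans (cong (T ℚ.*_) (ℚₚ.*-inverseʳ δ)) (ℚₚ.*-identityʳ T)))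

  module Tail (b : ℚ) (b≥0 : 0ℚ ℚ.≤ b) (K : ℕ) (b+b≤K : b ℚ.+ b ℚ.≤ + suc K / 1) where

    T : ℚ
    T = expTerm K b

    T≥0 : 0ℚ ℚ.≤ T
    T≥0 = expTerm-nonneg K b≥0

    ratio : ∀ i → b ℚ.* (+ 1 / suc (i ℕ.+ K)) ℚ.≤ ½
    ratio i = let open ℚₚ.≤-Reasoning in begin
      b ℚ.* r                                    ≡⟨ rearr b r ⟩
      ½ ℚ.* ((b ℚ.+ b) ℚ.* r)                    ≤⟨ ℚₚ.*-monoˡ-≤-nonNeg ½ (ℚₚ.*-monoʳ-≤-nonNeg r {{nn (ℚₚ.<⇒≤ (ℚ-pos (i ℕ.+ K)))}} (ℚₚ.≤-trans b+b≤K (fromℕ-mono (ℕ.s≤s (ℕₚ.m≤n+m K i))))) ⟩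
      ½ ℚ.* ((+ suc (i ℕ.+ K) / 1) ℚ.* r)        ≡⟨ cong (½ ℚ.*_) (fromℕ-inv (i ℕ.+ K)) ⟩
      ½ ∎
      where
      r = + 1 / suc (i ℕ.+ K)
      rearr : ∀ x y → x ℚ.* y ≡ ½ ℚ.* ((x ℚ.+ x) ℚ.* y)
      rearr = solve 2 (λ x y → x :* y := con ½ :* ((x :+ x) :* y)) refl
        where open +-*-Solver

    term≤ : ∀ i → expTerm (i ℕ.+ K) b ℚ.≤ T ℚ.* pow½ i
    term≤ zero    = ℚₚ.≤-reflexive (sym (ℚₚ.*-identityʳ T))
    term≤ (suc i) = ℚₚ.≤-trans
      (*-mono (expTerm-nonneg (i ℕ.+ K) b≥0) (ℚₚ.<⇒≤ (ℚₚ.positive⁻¹ ½)) (term≤ i) (ratio i))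
      (ℚₚ.≤-reflexive (ℚₚ.*-assoc T (pow½ i) ½))

    tail≤ : ∀ a → ∣ a ∣ ℚ.≤ b → ∀ i j →
            ∣ expSum (j ℕ.+ (i ℕ.+ K)) a ℚ.- expSum (i ℕ.+ K) a ∣ ℚ.+ (T ℚ.+ T) ℚ.* pow½ (j ℕ.+ i)
              ℚ.≤ (T ℚ.+ T) ℚ.* pow½ i
    tail≤ a ha i zero = ℚₚ.≤-reflexive (trans (cong (λ z → ∣ z ∣ ℚ.+ (T ℚ.+ T) ℚ.* pow½ i) (ℚₚ.+-inverseʳ (expSum (i ℕ.+ K) a))) (ℚₚ.+-identityˡ _))
    tail≤ a ha i (suc j) = let open ℚₚ.≤-Reasoning in begin
      ∣ (E ℚ.+ t) ℚ.- E₀ ∣ ℚ.+ (T ℚ.+ T) ℚ.* (w ℚ.* ½)        ≤⟨ ℚₚ.+-monoˡ-≤ ((T ℚ.+ T) ℚ.* (w ℚ.* ½)) (ℚₚ.≤-trans (ℚₚ.≤-reflexive (cong ∣_∣ (rearr E t E₀))) (ℚₚ.∣p+q∣≤∣p∣+∣q∣ (E ℚ.- E₀) t)) ⟩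
      ∣ E ℚ.- E₀ ∣ ℚ.+ ∣ t ∣ ℚ.+ (T ℚ.+ T) ℚ.* (w ℚ.* ½)      ≤⟨ ℚₚ.+-monoˡ-≤ ((T ℚ.+ T) ℚ.* (w ℚ.* ½)) (ℚₚ.+-monoʳ-≤ ∣ E ℚ.- E₀ ∣ t≤) ⟩
      ∣ E ℚ.- E₀ ∣ ℚ.+ T ℚ.* w ℚ.+ (T ℚ.+ T) ℚ.* (w ℚ.* ½)    ≡⟨ collect ∣ E ℚ.- E₀ ∣ T w ⟩
      ∣ E ℚ.- E₀ ∣ ℚ.+ (T ℚ.+ T) ℚ.* w                        ≤⟨ tail≤ a ha i j ⟩
      (T ℚ.+ T) ℚ.* pow½ i ∎
      where
      E  = expSum (j ℕ.+ (i ℕ.+ K)) a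
      E₀ = expSum (i ℕ.+ K) a
      t  = expTerm (j ℕ.+ (i ℕ.+ K)) a
      w  = pow½ (j ℕ.+ i)
      t≤ : ∣ t ∣ ℚ.≤ T ℚ.* w
      t≤ = ℚₚ.≤-trans (expTerm-bound (j ℕ.+ (i ℕ.+ K)) ha)
           (subst (λ m → expTerm m b ℚ.≤ T ℚ.* w) (ℕₚ.+-assoc j i K) (term≤ (j ℕ.+ i)))
      rearr : ∀ x y z → (x ℚ.+ y) ℚ.- z ≡ (x ℚ.- z) ℚ.+ y
      rearr = solve 3 (λ x y z → (x :+ y) :- z := (x :- z) :+ y) refl
        where open +-*-Solver
      collect : ∀ d x y → d ℚ.+ x ℚ.* y ℚ.+ (x ℚ.+ x) ℚ.* (y ℚ.* ½) ≡ d ℚ.+ (x ℚ.+ x) ℚ.* y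
      collect = solve 3 (λ d x y → d :+ x :* y :+ (x :+ x) :* (y :* con ½) := d :+ (x :+ x) :* y) refl
        where open +-*-Solver

    tail : ∀ i a n → ∣ a ∣ ℚ.≤ b → i ℕ.+ K ℕ.≤ n →
           ∣ expSum n a ℚ.- expSum (i ℕ.+ K) a ∣ ℚ.≤ (T ℚ.+ T) ℚ.* pow½ i
    tail i a n ha h = subst (λ m → ∣ expSum m a ℚ.- expSum (i ℕ.+ K) a ∣ ℚ.≤ (T ℚ.+ T) ℚ.* pow½ i)
      (ℕₚ.m∸n+n≡m h)
      (ℚₚ.≤-trans (ℚₚ.≤-trans (ℚₚ.≤-reflexive (sym (ℚₚ.+-identityʳ _)))
                  (ℚₚ.+-monoʳ-≤ ∣ expSum ((n ℕ.∸ (i ℕ.+ K)) ℕ.+ (i ℕ.+ K)) a ℚ.- expSum (i ℕ.+ K) a ∣ (*-nonneg (ℚₚ.+-mono-≤ T≥0 T≥0) (ℚₚ.<⇒≤ (pow½-pos ((n ℕ.∸ (i ℕ.+ K)) ℕ.+ i))))))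
        (tail≤ a ha i (n ℕ.∸ (i ℕ.+ K))))

  approx-cauchy : ∀ {u : ℕ → ℚ} →
    (∀ δ → 0ℚ ℚ.< δ → ∃ λ v → Cauchy v × (∃ λ N → ∀ n → N ℕ.≤ n → ∣ u n ℚ.- v n ∣ ℚ.≤ δ)) → Cauchy u
  approx-cauchy {u} h ε ε>0 = go (h (ε ℚ.* ½ ℚ.* ½) (half-pos (half-pos ε>0)))
    where
    collect : ∀ x e → x ≡ e ℚ.* ½ ℚ.* ½ → x ℚ.+ (e ℚ.* ½ ℚ.+ x) ≡ e
    collect x e refl = trans (solve 2 (λ x y → x :+ (y :+ x) := (x :+ x) :+ y) refl (e ℚ.* ½ ℚ.* ½) (e ℚ.* ½))
      (trans (cong (ℚ._+ e ℚ.* ½) (halves (e ℚ.* ½))) (halves e))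
      where open +-*-Solver
    step : ∀ {δ} {v : ℕ → ℚ} m n → δ ≡ ε ℚ.* ½ ℚ.* ½ → ∣ u m ℚ.- v m ∣ ℚ.≤ δ → ∣ v m ℚ.- v n ∣ ℚ.≤ ε ℚ.* ½ →
           ∣ u n ℚ.- v n ∣ ℚ.≤ δ → ∣ u m ℚ.- u n ∣ ℚ.≤ ε
    step {δ} {v} m n δ≡ h₁ h₂ h₃ = begin
      ∣ u m ℚ.- u n ∣                                                  ≤⟨ triangle (u m) (v m) (u n) ⟩
      ∣ u m ℚ.- v m ∣ ℚ.+ ∣ v m ℚ.- u n ∣                              ≤⟨ ℚₚ.+-mono-≤ h₁ (triangle (v m) (v n) (u n)) ⟩
      δ ℚ.+ (∣ v m ℚ.- v n ∣ ℚ.+ ∣ v n ℚ.- u n ∣)                      ≤⟨ ℚₚ.+-monoʳ-≤ δ (ℚₚ.+-mono-≤ h₂ (subst (ℚ._≤ δ) (∣-∣-sym (u n) (v n)) h₃)) ⟩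
      δ ℚ.+ (ε ℚ.* ½ ℚ.+ δ)                                            ≡⟨ collect δ ε δ≡ ⟩
      ε ∎
      where open ℚₚ.≤-Reasoning
    go : (∃ λ v → Cauchy v × (∃ λ N → ∀ n → N ℕ.≤ n → ∣ u n ℚ.- v n ∣ ℚ.≤ ε ℚ.* ½ ℚ.* ½)) →
         ∃ λ N → ∀ m n → N ℕ.≤ m → N ℕ.≤ n → ∣ u m ℚ.- u n ∣ ℚ.≤ ε
    go (v , cv , N , uv) = go′ (cv (ε ℚ.* ½) (half-pos ε>0))
      where
      go′ : (∃ λ M → ∀ m n → M ℕ.≤ m → M ℕ.≤ n → ∣ v m ℚ.- v n ∣ ℚ.≤ ε ℚ.* ½) →
            ∃ λ N → ∀ m n → N ℕ.≤ m → N ℕ.≤ n → ∣ u m ℚ.- u n ∣ ℚ.≤ ε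
      go′ (M , vv) = N ℕ.⊔ M , λ m n m≥ n≥ →
        step {v = v} m n refl (uv m (ℕₚ.m⊔n≤o⇒m≤o N M m≥))
          (vv m n (ℕₚ.m⊔n≤o⇒n≤o N M m≥) (ℕₚ.m⊔n≤o⇒n≤o N M n≥))
          (uv n (ℕₚ.m⊔n≤o⇒m≤o N M n≥))

  expSum-approx : ∀ {s : ℕ → ℚ} {b N₁} → 0ℚ ℚ.≤ b → (∀ n → N₁ ℕ.≤ n → ∣ s n ∣ ℚ.≤ b) → ∀ δ → 0ℚ ℚ.< δ →
    ∃ λ L → ∃ λ N → ∀ n → N ℕ.≤ n → ∣ expSum n (s n) ℚ.- expSum L (s n) ∣ ℚ.≤ δ
  expSum-approx {s} {b} {N₁} b≥0 bs δ δ>0 = go (archimedes (b ℚ.+ b))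
    where
    go : (∃ λ K → b ℚ.+ b ℚ.≤ + suc K / 1) →
         ∃ λ L → ∃ λ N → ∀ n → N ℕ.≤ n → ∣ expSum n (s n) ℚ.- expSum L (s n) ∣ ℚ.≤ δ
    go (K , hK) = go′ (pow½-small (T ℚ.+ T) δ (ℚₚ.+-mono-≤ T≥0 T≥0) δ>0)
      where
      open Tail b b≥0 K hK
      go′ : (∃ λ i → (T ℚ.+ T) ℚ.* pow½ i ℚ.≤ δ) →
            ∃ λ L → ∃ λ N → ∀ n → N ℕ.≤ n → ∣ expSum n (s n) ℚ.- expSum L (s n) ∣ ℚ.≤ δ
      go′ (i , hi) = i ℕ.+ K , N₁ ℕ.⊔ (i ℕ.+ K) , λ n n≥ →
        ℚₚ.≤-trans (tail i (s n) n (bs n (ℕₚ.m⊔n≤o⇒m≤o N₁ (i ℕ.+ K) n≥)) (ℕₚ.m⊔n≤o⇒n≤o N₁ (i ℕ.+ K) n≥)) hi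

  abstract
    exp-cauchy : ∀ {s} → Cauchy s → Cauchy (λ n → expSum n (s n))
    exp-cauchy {s} cs = go (cauchy⇒bounded {s} cs)
      where
      go : EventuallyBounded s → Cauchy (λ n → expSum n (s n))
      go (k , N₁ , bs) = approx-cauchy {λ n → expSum n (s n)} λ δ δ>0 → go′ (expSum-approx {s} {_} {N₁} (0≤fromℕ (suc k)) bs δ δ>0)
        where
        go′ : ∀ {δ} → (∃ λ L → ∃ λ N → ∀ n → N ℕ.≤ n → ∣ expSum n (s n) ℚ.- expSum L (s n) ∣ ℚ.≤ δ) →
              ∃ λ v → Cauchy v × (∃ λ N → ∀ n → N ℕ.≤ n → ∣ expSum n (s n) ℚ.- v n ∣ ℚ.≤ δ)
        go′ (L , N , h) = (λ n → expSum L (s n)) , expSum-cauchy L {s} cs , N , h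

open Exp-Lemmas

exp : ℝ → ℝ
exp x = mkℝ (λ n → expSum n (seq x n)) (exp-cauchy {seq x} (cauchy x))

-- Inputs: total orders on the elements Fin n, given by their rank functions
-- (element i precedes element j iff rank i < rank j).

Order : ℕ → Set
Order = Permutation′

Precedes : ∀ {n} → Order n → Fin n → Fin n → Set
Precedes π i j = (π ⟨$⟩ʳ i) Fin.< (π ⟨$⟩ʳ j)

precedes? : ∀ {n} (π : Order n) i j → Dec (Precedes π i j)
precedes? π i j = (π ⟨$⟩ʳ i) Finₚ.<? (π ⟨$⟩ʳ j)

IsMin : ∀ {n} → Order n → Fin n → Set
IsMin π i = ∀ j → (π ⟨$⟩ʳ i) Fin.≤ (π ⟨$⟩ʳ j)

isMin? : ∀ {n} (π : Order n) i → Dec (IsMin π i)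
isMin? π i = Finₚ.all? λ j → (π ⟨$⟩ʳ i) Finₚ.≤? (π ⟨$⟩ʳ j)

-- All n! orders: choose the rank of element zero, then the relative order
-- of the remaining elements.
orders : ∀ n → List (Order n)
orders zero    = id ∷ []
orders (suc n) = cartesianProductWith (insert zero) (allFin (suc n)) (orders n)

-- Covering all orders with a list of length n! means that each is listed
-- exactly once (up to pointwise equality).
length-orders : ∀ n → length (orders n) ≡ n !
length-orders zero    = refl
length-orders (suc n) = trans
  (product (allFin (suc n)))
  (cong₂ ℕ._*_ (Listₚ.length-tabulate {n = suc n} (λ i → i)) (length-orders n))
  where
  product : ∀ rs → length (cartesianProductWith (insert zero) rs (orders n)) ≡ length rs ℕ.* length (orders n)
  product []       = refl
  product (r ∷ rs) = trans (Listₚ.length-++ (map (insert zero r) (orders n)))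
    (cong₂ ℕ._+_ (Listₚ.length-map (insert zero r) (orders n)) (product rs))

orders-complete : ∀ n (π : Order n) → Any (π ≈_) (orders n)
orders-complete zero    π = here λ ()
orders-complete (suc n) π =
  Anyₚ.cartesianProductWith⁺ (insert zero) combine
    (∈-allFin (π ⟨$⟩ʳ zero)) (orders-complete n (remove zero π))
  where
  combine : ∀ {r σ} → π ⟨$⟩ʳ zero ≡ r → remove zero π ≈ σ → π ≈ insert zero r σ
  combine refl h zero = refl
  combine {σ = σ} refl h (suc k) = trans (sym (insert-remove zero π (suc k)))
    (trans (insert-punchIn zero (π ⟨$⟩ʳ zero) (remove zero π) k)
    (trans (cong (Fin.punchIn (π ⟨$⟩ʳ zero)) (h k)) (sym (insert-punchIn zero (π ⟨$⟩ʳ zero) σ k))))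

record Distribution (k : ℕ) : Set where
  field
    prob      : Fin k → ℝ
    nonneg    : ∀ i → 0ℝ ≤ prob i
    sums-to-1 : ∑ (allFin k) prob ≃ 1ℝ

open Distribution public

-- Randomised adaptive algorithms on n elements making at most q comparisons
-- on every run.  A query of i and j receives the answer true for "i precedes
-- j" and false for "j precedes i".  Random choices may be made at any time,
-- with arbitrary real probabilities, and are free of charge.
data Alg (n : ℕ) : ℕ → Set where
  output : ∀ {q} → Fin n → Alg n q
  query  : ∀ {q} (i j : Fin n) → i ≢ j → (Bool → Alg n q) → Alg n (suc q)
  random : ∀ {q k} → Distribution k → (Fin k → Alg n q) → Alg n q

successOn : ∀ {n q} → ℝ → Order n → Alg n q → ℝ
successOn γ π (output i) = if does (isMin? π i) then 1ℝ else 0ℝ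
successOn γ π (query i j _ next) =
    (fromℚ ½ + fromℚ ½ * γ) * successOn γ π (next correct)
  + (fromℚ ½ - fromℚ ½ * γ) * successOn γ π (next (not correct))
  where correct = does (precedes? π i j)
successOn γ π (random {k = k} D next) = ∑ (allFin k) λ i → prob D i * successOn γ π (next i)

-- Averaged over a uniformly random order.
successProbability : ∀ {n q} → ℝ → Alg n q → ℝ
successProbability {n} γ A =
  fromℚ ((+ 1 / (n !)) {{ℕₚ._!≢0 n}}) * ∑ (orders n) (λ π → successOn γ π A)

{-# OPTIONS --safe #-}
module Submission where

-- For a rank k ≠ 0 let π′ be the order π with its element x of rank k moved to
-- the front.  Only comparisons involving x are answered differently under π
-- and π′, and no output is the minimum of both.  Let a and b be the likelihoods
-- of a transcript under π and π′, and z ≥ a²/b.  Since min(a, b) ≥ 2ta − t²z for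
-- t ≤ ½, the failure probabilities under π and π′ add up to at least
-- 2t·P(x is compared at most M times) − t²·Σ z, the sum being over transcripts
-- with at most M comparisons of x; there Σ z ≤ (1 + 5γ²)^M.  Left multiplication
-- by the cycle that moves rank k to the front permutes the orders, and the
-- expected numbers of comparisons of x add up to at most 2q over all k.  By
-- Markov's inequality M ≈ 8q/n gives failure probability ≥ t/2 as soon as
-- t (1 + 5γ²)^M ≤ ½; because Mγ² ≤ 17c, t = ½ exp(−85c) qualifies.

-- Moving a fixed element to the front would be many-to-one on orders; fixing the rank makes the map
-- a bijection, so `π′` is again uniform. The two orders are not symmetric: under `π′` the element x
-- is the minimum, on which an algorithm may spend nearly all of its comparisons. Hence the lower
-- bound for min(a, b) has its main term in a alone, and comparisons of x are counted under `π`
-- only, where an average rank gets few of them.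
--
-- The second moment a²/b is multiplicative along a transcript: summed over the two answers of a
-- distinguishing comparison it grows by the factor p²/p̄ + p̄²/p = 1 + 4γ²/(1 - γ²), the terms
-- linear in γ cancelling. This is the source of γ² and, for γ ≤ 1/4, of the constant 5.
--
-- Division, square roots and case distinctions are awkward for Cauchy reals. So z is carried as a
-- free weight with a² ≤ bz, sums over transcripts become an induction on the decision tree, and
-- Markov's inequality enters as a linear term.

open import Algebra.Bundles using (CommutativeMonoid)
import Algebra.Properties.CommutativeMonoid.Sum as Sum
open import Data.Bool using (Bool; true; false; not; if_then_else_)
open import Data.Empty using (⊥-elim)
open import Data.Fin using (Fin; zero; suc; punchIn; punchOut)
import Data.Fin as Fin
open import Data.Fin.Permutation using (Permutation′; _⟨$⟩ʳ_; _⟨$⟩ˡ_; _≈_; _∘ₚ_; insert; remove; insert-punchIn; punchIn-permute; inverseʳ; id)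
import Data.Fin.Properties as Finₚ
open import Data.Integer using (+_)
open import Data.List using (List; []; _∷_; _++_; map; length; allFin; tabulate; cartesianProductWith)
open import Data.List.Properties using (length-tabulate)
open import Data.Nat using (ℕ; zero; suc; _!; NonZero)
import Data.Nat as ℕ
import Data.Nat.DivMod as DivMod
import Data.Nat.Properties as ℕₚ
open import Data.Product using (∃; _×_; _,_; proj₁; proj₂)
open import Data.Rational using (ℚ; 0ℚ; 1ℚ; ½; _/_; ∣_∣)
import Data.Rational as ℚ
import Data.Rational.Properties as ℚₚ
open import Data.Rational.Solver using (module +-*-Solver)
open import Data.Sum using (_⊎_; inj₁; inj₂)
open import Defs
open import Function using (mk⇔; _∘_)
open import Level using (0ℓ)
open import Relation.Binary.PropositionalEquality using (_≡_; _≢_; refl; sym; trans; cong; cong₂; subst; subst₂; module ≡-Reasoning)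
open import Relation.Nullary using (Dec; yes; no; does; ¬_; contradiction)
open import Relation.Nullary.Decidable using (does-⇔; dec-true; dec-false)
open ℚ-Lemmas
open Cauchy-Lemmas
open Exp-Lemmas
open +-*-Solver using (solve; _:+_; _:*_; _:-_; :-_; _:=_; con)

-- Ordered-ring reasoning for Cauchy reals

infix 4 _≐_ _≼_

-- Records rather than functions, so that the endpoints can be inferred.
record _≐_ (x y : ℝ) : Set where
  constructor pointwise
  field at : ∀ k → seq x k ≡ seq y k
open _≐_

record _≼_ (x y : ℝ) : Set where
  constructor mk≼
  field un≼ : x ≤ y
open _≼_

≐-refl : ∀ {x} → x ≐ x
≐-refl = pointwise λ _ → refl

≐-sym : ∀ {x y} → x ≐ y → y ≐ x
≐-sym h = pointwise λ k → sym (at h k)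

≐-trans : ∀ {x y z} → x ≐ y → y ≐ z → x ≐ z
≐-trans h h′ = pointwise λ k → trans (at h k) (at h′ k)

+-cong : ∀ {x x′ y y′} → x ≐ x′ → y ≐ y′ → x + y ≐ x′ + y′
+-cong h h′ = pointwise λ k → cong₂ ℚ._+_ (at h k) (at h′ k)

*-cong : ∀ {x x′ y y′} → x ≐ x′ → y ≐ y′ → x * y ≐ x′ * y′
*-cong h h′ = pointwise λ k → cong₂ ℚ._*_ (at h k) (at h′ k)

p≤p+ε : ∀ {p ε} → 0ℚ ℚ.< ε → p ℚ.≤ p ℚ.+ ε
p≤p+ε {p} ε>0 = ℚₚ.≤-trans (ℚₚ.≤-reflexive (sym (ℚₚ.+-identityʳ p))) (ℚₚ.+-monoʳ-≤ p (ℚₚ.<⇒≤ ε>0))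

≐⇒≼ : ∀ {x y} → x ≐ y → x ≼ y
≐⇒≼ h = mk≼ λ ε ε>0 → 0 , λ n _ → ℚₚ.≤-trans (ℚₚ.≤-reflexive (at h n)) (p≤p+ε ε>0)

≼-refl : ∀ {x} → x ≼ x
≼-refl = ≐⇒≼ ≐-refl

≼-trans : ∀ {x y z} → x ≼ y → y ≼ z → x ≼ z
≼-trans {x} {y} {z} (mk≼ h) (mk≼ h′) = mk≼ go
  where
  go : x ≤ z
  go ε ε>0 with h (ε ℚ.* ½) (half-pos ε>0) | h′ (ε ℚ.* ½) (half-pos ε>0)
  ... | N , p | M , q = N ℕ.⊔ M , λ n n≥ → let open ℚₚ.≤-Reasoning in begin
    seq x n                                  ≤⟨ p n (ℕₚ.m⊔n≤o⇒m≤o N M n≥) ⟩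
    seq y n ℚ.+ ε ℚ.* ½                      ≤⟨ ℚₚ.+-monoˡ-≤ (ε ℚ.* ½) (q n (ℕₚ.m⊔n≤o⇒n≤o N M n≥)) ⟩
    seq z n ℚ.+ ε ℚ.* ½ ℚ.+ ε ℚ.* ½          ≡⟨ ℚₚ.+-assoc (seq z n) _ _ ⟩
    seq z n ℚ.+ (ε ℚ.* ½ ℚ.+ ε ℚ.* ½)        ≡⟨ cong (seq z n ℚ.+_) (halves ε) ⟩
    seq z n ℚ.+ ε ∎

<⇒≼ : ∀ {x y} → x < y → x ≼ y
<⇒≼ {x} {y} (δ , δ>0 , N , h) = mk≼ λ ε ε>0 → N , λ n n≥ →
  ℚₚ.≤-trans (p≤p+ε δ>0) (ℚₚ.≤-trans (h n n≥) (p≤p+ε ε>0))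

infixr 2 _≼⟨_⟩_ _≐⟨_⟩_
infix  3 _■

_≼⟨_⟩_ : ∀ x {y z} → x ≼ y → y ≼ z → x ≼ z
_ ≼⟨ h ⟩ h′ = ≼-trans h h′

_≐⟨_⟩_ : ∀ x {y z} → x ≐ y → y ≼ z → x ≼ z
_ ≐⟨ h ⟩ h′ = ≼-trans (≐⇒≼ h) h′

_■ : ∀ x → x ≼ x
_ ■ = ≼-refl

+-mono-≼ : ∀ {x x′ y y′} → x ≼ x′ → y ≼ y′ → x + y ≼ x′ + y′
+-mono-≼ {x} {x′} {y} {y′} (mk≼ h) (mk≼ h′) = mk≼ go
  where
  go : x + y ≤ x′ + y′
  go ε ε>0 with h (ε ℚ.* ½) (half-pos ε>0) | h′ (ε ℚ.* ½) (half-pos ε>0)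
  ... | N , p | M , q = N ℕ.⊔ M , λ n n≥ → ℚₚ.≤-trans
    (ℚₚ.+-mono-≤ (p n (ℕₚ.m⊔n≤o⇒m≤o N M n≥)) (q n (ℕₚ.m⊔n≤o⇒n≤o N M n≥)))
    (ℚₚ.≤-reflexive (trans (solve 3 (λ u v e → (u :+ e) :+ (v :+ e) := (u :+ v) :+ (e :+ e)) refl (seq x′ n) (seq y′ n) (ε ℚ.* ½))
      (cong (seq x′ n ℚ.+ seq y′ n ℚ.+_) (halves ε))))

fromℚ-mono : ∀ {p q} → p ℚ.≤ q → fromℚ p ≼ fromℚ q
fromℚ-mono h = mk≼ λ ε ε>0 → 0 , λ _ _ → ℚₚ.≤-trans h (p≤p+ε ε>0)

p≤∣p∣ : ∀ p → p ℚ.≤ ∣ p ∣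
p≤∣p∣ p with ℚₚ.≤-total 0ℚ p
... | inj₁ h = ℚₚ.≤-reflexive (sym (ℚₚ.0≤p⇒∣p∣≡p h))
... | inj₂ h = ℚₚ.≤-trans h (ℚₚ.0≤∣p∣ p)

unitFraction≤1 : ∀ j → (+ 1 / suc j) ℚ.≤ 1ℚ
unitFraction≤1 j = begin
  + 1 / suc j                        ≡⟨ sym (ℚₚ.*-identityˡ _) ⟩
  (+ 1 / 1) ℚ.* (+ 1 / suc j)        ≤⟨ ℚₚ.*-monoʳ-≤-nonNeg (+ 1 / suc j) {{nn (ℚₚ.<⇒≤ (ℚ-pos j))}} (fromℕ-mono {1} {suc j} (ℕ.s≤s ℕ.z≤n)) ⟩
  (+ suc j / 1) ℚ.* (+ 1 / suc j)    ≡⟨ fromℕ-inv j ⟩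
  1ℚ                                 ∎
  where open ℚₚ.≤-Reasoning

0≼fromℕ : ∀ k → 0ℝ ≼ fromℕ k
0≼fromℕ k = fromℚ-mono (0≤fromℕ k)

0≼1 : 0ℝ ≼ 1ℝ
0≼1 = 0≼fromℕ 1

0≼½ : 0ℝ ≼ fromℚ ½
0≼½ = fromℚ-mono (ℚₚ.≤ᵇ⇒≤ {0ℚ} {½} _)

0≼+ : ∀ {x y} → 0ℝ ≼ x → 0ℝ ≼ y → 0ℝ ≼ x + y
0≼+ h h′ = ≼-trans (≐⇒≼ (pointwise λ _ → refl)) (+-mono-≼ h h′)

-- Nonnegative reals may have entries as low as -δ. Expanding (u + δ)(v + δ) ≥ 0 gives uv ≥ -δ(u + v
-- + δ); as the entries are bounded by K and L, δ = ε/(j + 1) with j + 1 ≥ K + L + ε makes the error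
-- at most ε.
0≼* : ∀ {x y} → 0ℝ ≼ x → 0ℝ ≼ y → 0ℝ ≼ x * y
0≼* {x} {y} (mk≼ hx) (mk≼ hy) = mk≼ λ ε ε>0 → go ε ε>0 (cauchy⇒bounded {seq x} (cauchy x)) (cauchy⇒bounded {seq y} (cauchy y))
  where
  bound : ∀ {u v δ K L ε} → 0ℚ ℚ.< δ → 0ℚ ℚ.≤ u ℚ.+ δ → 0ℚ ℚ.≤ v ℚ.+ δ → u ℚ.≤ K → v ℚ.≤ L →
          δ ℚ.* (K ℚ.+ L ℚ.+ ε) ℚ.≤ ε → δ ℚ.≤ ε → 0ℚ ℚ.≤ u ℚ.* v ℚ.+ ε
  bound {u} {v} {δ} {K} {L} {ε} δ>0 hu hv uK vL small δ≤ε = begin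
    0ℚ                                       ≤⟨ *-nonneg hu hv ⟩
    (u ℚ.+ δ) ℚ.* (v ℚ.+ δ)                  ≡⟨ solve 3 (λ u v d → (u :+ d) :* (v :+ d) := u :* v :+ d :* (u :+ v :+ d)) refl u v δ ⟩
    u ℚ.* v ℚ.+ δ ℚ.* (u ℚ.+ v ℚ.+ δ)        ≤⟨ ℚₚ.+-monoʳ-≤ (u ℚ.* v) (ℚₚ.*-monoˡ-≤-nonNeg δ {{nn (ℚₚ.<⇒≤ δ>0)}} (ℚₚ.+-mono-≤ (ℚₚ.+-mono-≤ uK vL) δ≤ε)) ⟩
    u ℚ.* v ℚ.+ δ ℚ.* (K ℚ.+ L ℚ.+ ε)        ≤⟨ ℚₚ.+-monoʳ-≤ (u ℚ.* v) small ⟩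
    u ℚ.* v ℚ.+ ε                            ∎
    where open ℚₚ.≤-Reasoning
  go : ∀ ε → 0ℚ ℚ.< ε → EventuallyBounded (seq x) → EventuallyBounded (seq y) →
       ∃ λ N → ∀ n → N ℕ.≤ n → 0ℚ ℚ.≤ seq x n ℚ.* seq y n ℚ.+ ε
  go ε ε>0 (k , N₁ , bx) (l , N₂ , by)
    with archimedes ((+ suc k / 1) ℚ.+ (+ suc l / 1) ℚ.+ ε)
  ... | j , hj with hx (ε ℚ.* (+ 1 / suc j)) (*-pos ε>0 (ℚ-pos j)) | hy (ε ℚ.* (+ 1 / suc j)) (*-pos ε>0 (ℚ-pos j))
  ... | N₃ , px | N₄ , py = (N₁ ℕ.⊔ N₂) ℕ.⊔ (N₃ ℕ.⊔ N₄) , λ n n≥ →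
      let h₁ = ℕₚ.m⊔n≤o⇒m≤o (N₁ ℕ.⊔ N₂) (N₃ ℕ.⊔ N₄) n≥
          h₂ = ℕₚ.m⊔n≤o⇒n≤o (N₁ ℕ.⊔ N₂) (N₃ ℕ.⊔ N₄) n≥
      in bound {seq x n} {seq y n} (*-pos ε>0 (ℚ-pos j))
        (px n (ℕₚ.m⊔n≤o⇒m≤o N₃ N₄ h₂)) (py n (ℕₚ.m⊔n≤o⇒n≤o N₃ N₄ h₂))
        (ℚₚ.≤-trans (p≤∣p∣ _) (bx n (ℕₚ.m⊔n≤o⇒m≤o N₁ N₂ h₁)))
        (ℚₚ.≤-trans (p≤∣p∣ _) (by n (ℕₚ.m⊔n≤o⇒n≤o N₁ N₂ h₁)))
        small (ℚₚ.≤-trans (ℚₚ.*-monoˡ-≤-nonNeg ε {{nn (ℚₚ.<⇒≤ ε>0)}} (unitFraction≤1 j)) (ℚₚ.≤-reflexive (ℚₚ.*-identityʳ ε)))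
    where
    r = + 1 / suc j
    small : ε ℚ.* r ℚ.* ((+ suc k / 1) ℚ.+ (+ suc l / 1) ℚ.+ ε) ℚ.≤ ε
    small = begin
      ε ℚ.* r ℚ.* ((+ suc k / 1) ℚ.+ (+ suc l / 1) ℚ.+ ε)  ≤⟨ ℚₚ.*-monoˡ-≤-nonNeg (ε ℚ.* r) {{nn (*-nonneg (ℚₚ.<⇒≤ ε>0) (ℚₚ.<⇒≤ (ℚ-pos j)))}} hj ⟩
      ε ℚ.* r ℚ.* (+ suc j / 1)                            ≡⟨ solve 3 (λ e r s → e :* r :* s := e :* (s :* r)) refl ε r (+ suc j / 1) ⟩
      ε ℚ.* ((+ suc j / 1) ℚ.* r)                          ≡⟨ cong (ε ℚ.*_) (fromℕ-inv j) ⟩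
      ε ℚ.* 1ℚ                                             ≡⟨ ℚₚ.*-identityʳ ε ⟩
      ε                                                    ∎
      where open ℚₚ.≤-Reasoning

-- The standard way to an inequality below: exhibit the slack `s`, whose sign is evident from its
-- form, and leave the identity to the ring solver.
≼-by : ∀ {x y} s → 0ℝ ≼ s → y ≐ x + s → x ≼ y
≼-by {x} {y} s h e = ≼-trans (≐⇒≼ (pointwise λ k → sym (ℚₚ.+-identityʳ (seq x k))))
  (≼-trans (+-mono-≼ ≼-refl h) (≐⇒≼ (≐-sym e)))

≼⇒0≼- : ∀ {x y} → x ≼ y → 0ℝ ≼ y - x
≼⇒0≼- {x} {y} h = ≼-trans (≐⇒≼ (pointwise λ k → sym (ℚₚ.+-inverseʳ (seq x k)))) (+-mono-≼ h ≼-refl)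

0≼-⇒≼ : ∀ {x y} → 0ℝ ≼ y - x → x ≼ y
0≼-⇒≼ {x} {y} h = ≼-by (y - x) h
  (pointwise λ k → solve 2 (λ x y → y := x :+ (y :- x)) refl (seq x k) (seq y k))

*-monoˡ-≼ : ∀ {x y} z → 0ℝ ≼ z → x ≼ y → z * x ≼ z * y
*-monoˡ-≼ {x} {y} z hz h = ≼-by (z * (y - x)) (0≼* hz (≼⇒0≼- h))
  (pointwise λ k → solve 3 (λ x y z → z :* y := z :* x :+ z :* (y :- x)) refl (seq x k) (seq y k) (seq z k))

*-mono-≼ : ∀ {x x′ y y′} → 0ℝ ≼ x → 0ℝ ≼ y′ → x ≼ x′ → y ≼ y′ → x * y ≼ x′ * y′
*-mono-≼ {x} {x′} {y} {y′} hx hy′ h h′ =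
  x * y    ≼⟨ *-monoˡ-≼ x hx h′ ⟩
  x * y′   ≐⟨ pointwise (λ k → ℚₚ.*-comm (seq x k) (seq y′ k)) ⟩
  y′ * x   ≼⟨ *-monoˡ-≼ y′ hy′ h ⟩
  y′ * x′  ≐⟨ pointwise (λ k → ℚₚ.*-comm (seq y′ k) (seq x′ k)) ⟩
  x′ * y′  ■

*-cancelˡ-≼ : ∀ {x y} k → fromℕ (suc k) * x ≼ fromℕ (suc k) * y → x ≼ y
*-cancelˡ-≼ {x} {y} k h =
  x                       ≐⟨ undo x ⟩
  r * (fromℕ (suc k) * x)  ≼⟨ *-monoˡ-≼ r (fromℚ-mono (ℚₚ.<⇒≤ (ℚ-pos k))) h ⟩
  r * (fromℕ (suc k) * y)  ≐⟨ ≐-sym (undo y) ⟩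
  y                       ■
  where
  r = fromℚ (+ 1 / suc k)
  undo : ∀ x → x ≐ r * (fromℕ (suc k) * x)
  undo x = pointwise λ i → sym (trans
    (solve 3 (λ r s x → r :* (s :* x) := (s :* r) :* x) refl (+ 1 / suc k) (+ suc k / 1) (seq x i))
    (trans (cong (ℚ._* seq x i) (fromℕ-inv k)) (ℚₚ.*-identityˡ (seq x i))))

-- Stands in for taking square roots. For rational entries, u ≥ v + ε and v ≥ -ε/4 would give u² ≥
-- v² + ε²/2, against u² ≤ v² + ε²/4.
x²≼y²⇒x≼y : ∀ {x y} → 0ℝ ≼ y → x * x ≼ y * y → x ≼ y
x²≼y²⇒x≼y {x} {y} (mk≼ hy) (mk≼ h) = mk≼ go
  where
  excess : ∀ {u v ε} → 0ℚ ℚ.< ε → 0ℚ ℚ.≤ v ℚ.+ ε ℚ.* ½ ℚ.* ½ → v ℚ.+ ε ℚ.≤ u →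
           v ℚ.* v ℚ.+ ε ℚ.* ε ℚ.* ½ ℚ.≤ u ℚ.* u
  excess {u} {v} {ε} ε>0 hf he = begin
    v ℚ.* v ℚ.+ ε ℚ.* ε ℚ.* ½                      ≡⟨ sym (ℚₚ.+-identityʳ _) ⟩
    v ℚ.* v ℚ.+ ε ℚ.* ε ℚ.* ½ ℚ.+ 0ℚ               ≤⟨ ℚₚ.+-monoʳ-≤ (v ℚ.* v ℚ.+ ε ℚ.* ε ℚ.* ½)
        (ℚₚ.+-mono-≤ (*-nonneg ε≥0 (ℚₚ.+-mono-≤ (ℚₚ.+-mono-≤ hf hf) e≥0))
          (*-nonneg e≥0 (ℚₚ.+-mono-≤ (ℚₚ.+-mono-≤ (*-nonneg ε≥0 (ℚₚ.<⇒≤ (ℚₚ.positive⁻¹ ½))) (ℚₚ.+-mono-≤ hf hf)) e≥0))) ⟩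
    v ℚ.* v ℚ.+ ε ℚ.* ε ℚ.* ½ ℚ.+ (ε ℚ.* (f ℚ.+ f ℚ.+ e) ℚ.+ e ℚ.* (ε ℚ.* ½ ℚ.+ (f ℚ.+ f) ℚ.+ e))
                                                   ≡⟨ solve 3 (λ u v d →
          v :* v :+ d :* d :* con ½ :+ (d :* ((v :+ d :* con ½ :* con ½) :+ (v :+ d :* con ½ :* con ½) :+ (u :- (v :+ d)))
            :+ (u :- (v :+ d)) :* (d :* con ½ :+ ((v :+ d :* con ½ :* con ½) :+ (v :+ d :* con ½ :* con ½)) :+ (u :- (v :+ d))))
          := u :* u) refl u v ε ⟩
    u ℚ.* u                                        ∎
    where
    open ℚₚ.≤-Reasoning
    e = u ℚ.- (v ℚ.+ ε)
    f = v ℚ.+ ε ℚ.* ½ ℚ.* ½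
    ε≥0 = ℚₚ.<⇒≤ ε>0
    e≥0 : 0ℚ ℚ.≤ e
    e≥0 = ℚₚ.≤-trans (ℚₚ.≤-reflexive (sym (ℚₚ.+-inverseʳ (v ℚ.+ ε)))) (ℚₚ.+-monoˡ-≤ (ℚ.- (v ℚ.+ ε)) he)
  go : x ≤ y
  go ε ε>0 with hy (ε ℚ.* ½ ℚ.* ½) (half-pos (half-pos ε>0))
              | h (ε ℚ.* ε ℚ.* ½ ℚ.* ½) (half-pos (half-pos (*-pos ε>0 ε>0)))
  ... | N , p | M , q = N ℕ.⊔ M , bound
    where
    bound : ∀ n → N ℕ.⊔ M ℕ.≤ n → seq x n ℚ.≤ seq y n ℚ.+ ε
    bound n n≥ with seq x n ℚₚ.≤? seq y n ℚ.+ ε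
    ... | yes x≤ = x≤
    ... | no x≰ = ⊥-elim (ℚₚ.<-irrefl refl (ℚₚ.<-≤-trans quarter<half (ℚₚ.≤-trans (excess {seq x n} {seq y n} ε>0 (p n (ℕₚ.m⊔n≤o⇒m≤o N M n≥)) (ℚₚ.<⇒≤ (ℚₚ.≰⇒> x≰)))
                      (q n (ℕₚ.m⊔n≤o⇒n≤o N M n≥)))))
      where
      η = ε ℚ.* ε ℚ.* ½
      quarter<half : seq y n ℚ.* seq y n ℚ.+ η ℚ.* ½ ℚ.< seq y n ℚ.* seq y n ℚ.+ η
      quarter<half = ℚₚ.+-monoʳ-< (seq y n ℚ.* seq y n)
        (ℚₚ.<-respʳ-≡ (halves η) (ℚₚ.≤-<-trans (ℚₚ.≤-reflexive (sym (ℚₚ.+-identityʳ (η ℚ.* ½))))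
          (ℚₚ.+-monoʳ-< (η ℚ.* ½) (half-pos (half-pos (*-pos ε>0 ε>0))))))

0≤p*p : ∀ p → 0ℚ ℚ.≤ p ℚ.* p
0≤p*p p with ℚₚ.≤-total 0ℚ p
... | inj₁ h = *-nonneg h h
... | inj₂ h = ℚₚ.≤-trans (*-nonneg h′ h′) (ℚₚ.≤-reflexive (solve 1 (λ p → (:- p) :* (:- p) := p :* p) refl p))
  where h′ = ℚₚ.neg-antimono-≤ h

0≼x*x : ∀ x → 0ℝ ≼ x * x
0≼x*x x = mk≼ λ ε ε>0 → 0 , λ n _ → ℚₚ.≤-trans (0≤p*p (seq x n)) (p≤p+ε ε>0)

fromℕ-suc : ∀ m → fromℕ (suc m) ≐ 1ℝ + fromℕ m
fromℕ-suc m = pointwise λ _ → +1/1 m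

fromℕ-+ : ∀ m n → fromℕ (m ℕ.+ n) ≐ fromℕ m + fromℕ n
fromℕ-+ zero    n = pointwise λ _ → sym (ℚₚ.+-identityˡ _)
fromℕ-+ (suc m) n = pointwise λ k → trans (+1/1 (m ℕ.+ n)) (trans (cong (1ℚ ℚ.+_) (at (fromℕ-+ m n) k))
  (trans (sym (ℚₚ.+-assoc 1ℚ (+ m / 1) (+ n / 1))) (cong (ℚ._+ (+ n / 1)) (sym (+1/1 m)))))

fromℕ-* : ∀ m n → fromℕ (m ℕ.* n) ≐ fromℕ m * fromℕ n
fromℕ-* zero    n = pointwise λ _ → sym (ℚₚ.*-zeroˡ (+ n / 1))
fromℕ-* (suc m) n = pointwise λ k → trans (at (fromℕ-+ n (m ℕ.* n)) k) (trans (cong ((+ n / 1) ℚ.+_) (at (fromℕ-* m n) k))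
  (trans (solve 2 (λ m n → n :+ m :* n := (con 1ℚ :+ m) :* n) refl (+ m / 1) (+ n / 1)) (cong (ℚ._* (+ n / 1)) (sym (+1/1 m)))))

fromℕ-inverse : ∀ m .{{_ : NonZero m}} → (+ m / 1) ℚ.* (+ 1 / m) ≡ 1ℚ
fromℕ-inverse (suc m) = fromℕ-inv m

0≤1/ : ∀ m .{{_ : NonZero m}} → 0ℚ ℚ.≤ + 1 / m
0≤1/ (suc m) = ℚₚ.<⇒≤ (ℚ-pos m)

-- Finite sums

∑-cong : ∀ {A : Set} (xs : List A) {f g : A → ℝ} → (∀ x → f x ≐ g x) → ∑ xs f ≐ ∑ xs g
∑-cong []       h = ≐-refl
∑-cong (x ∷ xs) h = +-cong (h x) (∑-cong xs h)

∑-mono : ∀ {A : Set} (xs : List A) {f g : A → ℝ} → (∀ x → f x ≼ g x) → ∑ xs f ≼ ∑ xs g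
∑-mono []       h = ≼-refl
∑-mono (x ∷ xs) h = +-mono-≼ (h x) (∑-mono xs h)

∑-zero : ∀ {A : Set} (xs : List A) → ∑ xs (λ _ → 0ℝ) ≐ 0ℝ
∑-zero []       = ≐-refl
∑-zero (x ∷ xs) = pointwise λ k → trans (ℚₚ.+-identityˡ _) (at (∑-zero xs) k)

∑-+ : ∀ {A : Set} (xs : List A) (f g : A → ℝ) → ∑ xs (λ x → f x + g x) ≐ ∑ xs f + ∑ xs g
∑-+ []       f g = pointwise λ _ → refl
∑-+ (x ∷ xs) f g = pointwise λ k → trans (cong (seq (f x) k ℚ.+ seq (g x) k ℚ.+_) (at (∑-+ xs f g) k))
  (solve 4 (λ a b c d → (a :+ b) :+ (c :+ d) := (a :+ c) :+ (b :+ d)) refl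
    (seq (f x) k) (seq (g x) k) (seq (∑ xs f) k) (seq (∑ xs g) k))

∑-*ˡ : ∀ {A : Set} (xs : List A) c (f : A → ℝ) → ∑ xs (λ x → c * f x) ≐ c * ∑ xs f
∑-*ˡ []       c f = pointwise λ k → sym (ℚₚ.*-zeroʳ (seq c k))
∑-*ˡ (x ∷ xs) c f = pointwise λ k → trans (cong (seq c k ℚ.* seq (f x) k ℚ.+_) (at (∑-*ˡ xs c f) k))
  (sym (ℚₚ.*-distribˡ-+ (seq c k) (seq (f x) k) (seq (∑ xs f) k)))

∑-const : ∀ {A : Set} (xs : List A) c → ∑ xs (λ _ → c) ≐ fromℕ (length xs) * c
∑-const []       c = pointwise λ k → sym (ℚₚ.*-zeroˡ (seq c k))
∑-const (x ∷ xs) c = pointwise λ k → trans (cong (seq c k ℚ.+_) (at (∑-const xs c) k))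
  (trans (solve 2 (λ c l → c :+ l :* c := (con 1ℚ :+ l) :* c) refl (seq c k) (+ length xs / 1))
    (cong (ℚ._* seq c k) (sym (+1/1 (length xs)))))

∑-swap : ∀ {A B : Set} (xs : List A) (ys : List B) (f : A → B → ℝ) →
         ∑ xs (λ x → ∑ ys (f x)) ≐ ∑ ys (λ y → ∑ xs (λ x → f x y))
∑-swap []       ys f = ≐-sym (∑-zero ys)
∑-swap (x ∷ xs) ys f = ≐-trans (+-cong ≐-refl (∑-swap xs ys f)) (≐-sym (∑-+ ys (f x) _))

∑-++ : ∀ {A : Set} (xs ys : List A) (f : A → ℝ) → ∑ (xs ++ ys) f ≐ ∑ xs f + ∑ ys f
∑-++ []       ys f = pointwise λ k → sym (ℚₚ.+-identityˡ (seq (∑ ys f) k))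
∑-++ (x ∷ xs) ys f = pointwise λ k → trans (cong (seq (f x) k ℚ.+_) (at (∑-++ xs ys f) k))
  (sym (ℚₚ.+-assoc (seq (f x) k) (seq (∑ xs f) k) (seq (∑ ys f) k)))

∑-map : ∀ {A B : Set} (g : A → B) xs (f : B → ℝ) → ∑ (map g xs) f ≐ ∑ xs (λ x → f (g x))
∑-map g []       f = ≐-refl
∑-map g (x ∷ xs) f = +-cong ≐-refl (∑-map g xs f)

∑-cartesianProductWith : ∀ {A B D : Set} (g : A → B → D) xs ys (f : D → ℝ) →
  ∑ (cartesianProductWith g xs ys) f ≐ ∑ xs (λ x → ∑ ys (λ y → f (g x y)))
∑-cartesianProductWith g []       ys f = ≐-refl
∑-cartesianProductWith g (x ∷ xs) ys f = ≐-trans (∑-++ (map (g x) ys) _ f)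
  (+-cong (∑-map (g x) ys f) (∑-cartesianProductWith g xs ys f))

-- The exponential function

ν : ℕ → ℚ
ν n = + n / 1

expTerm-step : ∀ k a → a ℚ.* expTerm k a ≡ ν (suc k) ℚ.* expTerm (suc k) a
expTerm-step k a = sym (trans
  (solve 4 (λ s t a r → s :* (t :* (a :* r)) := (s :* r) :* (a :* t)) refl (ν (suc k)) (expTerm k a) a (+ 1 / suc k))
  (trans (cong (ℚ._* (a ℚ.* expTerm k a)) (fromℕ-inv k)) (ℚₚ.*-identityˡ _)))

-- antidiagonal a b i j = Σ_{l≤i} (aˡ / l!) (b^(i+j−l) / (i+j−l)!)
antidiagonal : ℚ → ℚ → ℕ → ℕ → ℚ
antidiagonal a b zero    j = expTerm zero a ℚ.* expTerm j b
antidiagonal a b (suc i) j = antidiagonal a b i (suc j) ℚ.+ expTerm (suc i) a ℚ.* expTerm j b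

-- By `expTerm-step`, multiplying a product of terms by a raises its first degree and by b its
-- second, each with the raised degree as coefficient. Neighbouring products meet in the same term,
-- where the coefficients add up to the total degree; only the last product lacks a neighbour.
antidiagonal-step : ∀ a b i j → (a ℚ.+ b) ℚ.* antidiagonal a b i j ≡
  (ν (suc i) ℚ.+ ν j) ℚ.* antidiagonal a b i (suc j) ℚ.+ ν (suc i) ℚ.* (expTerm (suc i) a ℚ.* expTerm j b)
antidiagonal-step a b zero j = begin
  (a ℚ.+ b) ℚ.* (1ℚ ℚ.* u)                                                     ≡⟨ solve 3 (λ a b u → (a :+ b) :* (con 1ℚ :* u) := (a :* con 1ℚ) :* u :+ b :* u) refl a b u ⟩
  (a ℚ.* 1ℚ) ℚ.* u ℚ.+ b ℚ.* u                                                 ≡⟨ cong₂ (λ x y → x ℚ.* u ℚ.+ y) (expTerm-step 0 a) (trans (expTerm-step j b) (cong (ℚ._* u′) (+1/1 j))) ⟩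
  (1ℚ ℚ.* t) ℚ.* u ℚ.+ (1ℚ ℚ.+ ν j) ℚ.* u′                                     ≡⟨ solve 4 (λ t u w u′ → (con 1ℚ :* t) :* u :+ (con 1ℚ :+ w) :* u′ := (con 1ℚ :+ w) :* (con 1ℚ :* u′) :+ con 1ℚ :* (t :* u)) refl t u (ν j) u′ ⟩
  (1ℚ ℚ.+ ν j) ℚ.* (1ℚ ℚ.* u′) ℚ.+ 1ℚ ℚ.* (t ℚ.* u)                            ∎
  where
  open ≡-Reasoning
  u = expTerm j b
  u′ = expTerm (suc j) b
  t = expTerm 1 a
antidiagonal-step a b (suc i) j = begin
  (a ℚ.+ b) ℚ.* (A ℚ.+ t ℚ.* u)
    ≡⟨ solve 5 (λ a b A t u → (a :+ b) :* (A :+ t :* u) := (a :+ b) :* A :+ (a :* t) :* u :+ t :* (b :* u)) refl a b A t u ⟩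
  (a ℚ.+ b) ℚ.* A ℚ.+ (a ℚ.* t) ℚ.* u ℚ.+ t ℚ.* (b ℚ.* u)
    ≡⟨ cong₂ ℚ._+_ (cong₂ ℚ._+_ (antidiagonal-step a b i (suc j)) (cong (ℚ._* u) (expTerm-step (suc i) a))) (cong (t ℚ.*_) (expTerm-step j b)) ⟩
  ((x ℚ.+ ν (suc j)) ℚ.* A′ ℚ.+ x ℚ.* (t ℚ.* u′)) ℚ.+ (ν (suc (suc i)) ℚ.* t′) ℚ.* u ℚ.+ t ℚ.* (ν (suc j) ℚ.* u′)
    ≡⟨ cong₂ (λ y w → ((x ℚ.+ w) ℚ.* A′ ℚ.+ x ℚ.* (t ℚ.* u′)) ℚ.+ (y ℚ.* t′) ℚ.* u ℚ.+ t ℚ.* (w ℚ.* u′)) (+1/1 (suc i)) (+1/1 j) ⟩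
  ((x ℚ.+ (1ℚ ℚ.+ w)) ℚ.* A′ ℚ.+ x ℚ.* (t ℚ.* u′)) ℚ.+ ((1ℚ ℚ.+ x) ℚ.* t′) ℚ.* u ℚ.+ t ℚ.* ((1ℚ ℚ.+ w) ℚ.* u′)
    ≡⟨ solve 7 (λ x w A′ t u u′ t′ → ((x :+ (con 1ℚ :+ w)) :* A′ :+ x :* (t :* u′)) :+ ((con 1ℚ :+ x) :* t′) :* u :+ t :* ((con 1ℚ :+ w) :* u′)
         := ((con 1ℚ :+ x) :+ w) :* (A′ :+ t :* u′) :+ (con 1ℚ :+ x) :* (t′ :* u)) refl x w A′ t u u′ t′ ⟩
  ((1ℚ ℚ.+ x) ℚ.+ w) ℚ.* (A′ ℚ.+ t ℚ.* u′) ℚ.+ (1ℚ ℚ.+ x) ℚ.* (t′ ℚ.* u)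
    ≡⟨ cong (λ y → (y ℚ.+ w) ℚ.* (A′ ℚ.+ t ℚ.* u′) ℚ.+ y ℚ.* (t′ ℚ.* u)) (sym (+1/1 (suc i))) ⟩
  (ν (suc (suc i)) ℚ.+ w) ℚ.* (A′ ℚ.+ t ℚ.* u′) ℚ.+ ν (suc (suc i)) ℚ.* (t′ ℚ.* u) ∎
  where
  open ≡-Reasoning
  A = antidiagonal a b i (suc j)
  A′ = antidiagonal a b i (suc (suc j))
  t = expTerm (suc i) a
  t′ = expTerm (suc (suc i)) a
  u = expTerm j b
  u′ = expTerm (suc j) b
  x = ν (suc i)
  w = ν j

-- The binomial theorem divided by k!. At j = 0 both coefficients in `antidiagonal-step` are k + 1,
-- which cancels the 1/(k + 1) of `expTerm`.
expTerm-+ : ∀ a b k → expTerm k (a ℚ.+ b) ≡ antidiagonal a b k 0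
expTerm-+ a b zero    = refl
expTerm-+ a b (suc k) = begin
  expTerm k (a ℚ.+ b) ℚ.* ((a ℚ.+ b) ℚ.* r)               ≡⟨ cong (ℚ._* ((a ℚ.+ b) ℚ.* r)) (expTerm-+ a b k) ⟩
  D ℚ.* ((a ℚ.+ b) ℚ.* r)                                 ≡⟨ solve 3 (λ D s r → D :* (s :* r) := r :* (s :* D)) refl D (a ℚ.+ b) r ⟩
  r ℚ.* ((a ℚ.+ b) ℚ.* D)                                 ≡⟨ cong (r ℚ.*_) (antidiagonal-step a b k 0) ⟩
  r ℚ.* ((ν (suc k) ℚ.+ 0ℚ) ℚ.* A ℚ.+ ν (suc k) ℚ.* B)    ≡⟨ solve 4 (λ r s A B → r :* ((s :+ con 0ℚ) :* A :+ s :* B) := (s :* r) :* (A :+ B)) refl r (ν (suc k)) A B ⟩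
  (ν (suc k) ℚ.* r) ℚ.* (A ℚ.+ B)                         ≡⟨ cong (ℚ._* (A ℚ.+ B)) (fromℕ-inv k) ⟩
  1ℚ ℚ.* (A ℚ.+ B)                                        ≡⟨ ℚₚ.*-identityˡ _ ⟩
  A ℚ.+ B ∎
  where
  open ≡-Reasoning
  r = + 1 / suc k
  D = antidiagonal a b k 0
  A = antidiagonal a b k 1
  B = expTerm (suc k) a ℚ.* expTerm 0 b

-- trapezoid a b i j = Σ_{l<i} (aˡ / l!) expSum (i+j−l) b
trapezoid : ℚ → ℚ → ℕ → ℕ → ℚ
trapezoid a b zero    j = 0ℚ
trapezoid a b (suc i) j = trapezoid a b i (suc j) ℚ.+ expTerm i a ℚ.* expSum (suc j) b

trapezoid-suc : ∀ a b i j → trapezoid a b (suc i) (suc j) ≡ trapezoid a b (suc i) j ℚ.+ antidiagonal a b i (suc j)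
trapezoid-suc a b zero j = solve 3 (λ t s u → con 0ℚ :+ t :* (s :+ u) := (con 0ℚ :+ t :* s) :+ t :* u) refl 1ℚ (expSum (suc j) b) (expTerm (suc j) b)
trapezoid-suc a b (suc i) j = trans (cong (ℚ._+ expTerm (suc i) a ℚ.* expSum (suc (suc j)) b) (trapezoid-suc a b i (suc j)))
  (solve 5 (λ x y t s u → (x :+ y) :+ t :* (s :+ u) := (x :+ t :* s) :+ (y :+ t :* u)) refl
    (trapezoid a b (suc i) (suc j)) (antidiagonal a b i (suc (suc j))) (expTerm (suc i) a) (expSum (suc j) b) (expTerm (suc j) b))

expSum-+ : ∀ a b n → expSum n (a ℚ.+ b) ≡ trapezoid a b n 0
expSum-+ a b zero          = refl
expSum-+ a b (suc zero)    = refl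
expSum-+ a b (suc (suc n)) = begin
  expSum (suc n) (a ℚ.+ b) ℚ.+ expTerm (suc n) (a ℚ.+ b)     ≡⟨ cong₂ ℚ._+_ (expSum-+ a b (suc n)) (expTerm-+ a b (suc n)) ⟩
  Z ℚ.+ (A ℚ.+ t ℚ.* 1ℚ)                                     ≡⟨ solve 3 (λ Z A t → Z :+ (A :+ t :* con 1ℚ) := (Z :+ A) :+ t :* (con 0ℚ :+ con 1ℚ)) refl Z A t ⟩
  (Z ℚ.+ A) ℚ.+ t ℚ.* (0ℚ ℚ.+ 1ℚ)                            ≡⟨ cong (ℚ._+ t ℚ.* (0ℚ ℚ.+ 1ℚ)) (sym (trapezoid-suc a b n 0)) ⟩
  trapezoid a b (suc n) 1 ℚ.+ t ℚ.* (0ℚ ℚ.+ 1ℚ)              ∎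
  where
  open ≡-Reasoning
  Z = trapezoid a b (suc n) 0
  A = antidiagonal a b n 1
  t = expTerm (suc n) a

expSum-tail : ∀ {b β} → ∣ b ∣ ℚ.≤ β → ∀ {j n} → j ℕ.≤′ n →
              ∣ expSum n b ℚ.- expSum j b ∣ ℚ.≤ expSum n β ℚ.- expSum j β
expSum-tail {b} {β} h {j} ℕ.≤′-refl = ℚₚ.≤-reflexive
  (trans (cong ∣_∣ (ℚₚ.+-inverseʳ (expSum j b))) (sym (ℚₚ.+-inverseʳ (expSum j β))))
expSum-tail {b} {β} h {j} (ℕ.≤′-step {n} j≤n) = begin
  ∣ (expSum n b ℚ.+ expTerm n b) ℚ.- expSum j b ∣          ≡⟨ cong ∣_∣ (comm (expSum n b) (expTerm n b) (expSum j b)) ⟩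
  ∣ (expSum n b ℚ.- expSum j b) ℚ.+ expTerm n b ∣          ≤⟨ ℚₚ.∣p+q∣≤∣p∣+∣q∣ (expSum n b ℚ.- expSum j b) (expTerm n b) ⟩
  ∣ expSum n b ℚ.- expSum j b ∣ ℚ.+ ∣ expTerm n b ∣        ≤⟨ ℚₚ.+-mono-≤ (expSum-tail h j≤n) (expTerm-bound n h) ⟩
  (expSum n β ℚ.- expSum j β) ℚ.+ expTerm n β              ≡⟨ sym (comm (expSum n β) (expTerm n β) (expSum j β)) ⟩
  (expSum n β ℚ.+ expTerm n β) ℚ.- expSum j β              ∎
  where
  open ℚₚ.≤-Reasoning
  comm : ∀ x y z → (x ℚ.+ y) ℚ.- z ≡ (x ℚ.- z) ℚ.+ y
  comm = solve 3 (λ x y z → (x :+ y) :- z := (x :- z) :+ y) refl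

-- The part of the rectangle outside the trapezoid is a sum of products of terms, so the triangle
-- inequality replaces a and b by their bounds α and β.
rectangle-trapezoid : ∀ {a b α β} → ∣ a ∣ ℚ.≤ α → ∣ b ∣ ℚ.≤ β → ∀ n i j → i ℕ.+ j ℕ.≤ n →
  ∣ expSum i a ℚ.* expSum n b ℚ.- trapezoid a b i j ∣ ℚ.≤ expSum i α ℚ.* expSum n β ℚ.- trapezoid α β i j
rectangle-trapezoid {a} {b} {α} {β} ha hb n zero j i+j≤n = ℚₚ.≤-reflexive (trans
  (cong ∣_∣ (solve 1 (λ x → con 0ℚ :* x :- con 0ℚ := con 0ℚ) refl (expSum n b)))
  (sym (solve 1 (λ x → con 0ℚ :* x :- con 0ℚ := con 0ℚ) refl (expSum n β))))
rectangle-trapezoid {a} {b} {α} {β} ha hb n (suc i) j i+j≤n = begin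
  ∣ (expSum i a ℚ.+ t) ℚ.* expSum n b ℚ.- (trapezoid a b i (suc j) ℚ.+ t ℚ.* expSum (suc j) b) ∣
    ≡⟨ cong ∣_∣ (split (expSum i a) t (expSum n b) (trapezoid a b i (suc j)) (expSum (suc j) b)) ⟩
  ∣ (expSum i a ℚ.* expSum n b ℚ.- trapezoid a b i (suc j)) ℚ.+ t ℚ.* d ∣
    ≤⟨ ℚₚ.∣p+q∣≤∣p∣+∣q∣ (expSum i a ℚ.* expSum n b ℚ.- trapezoid a b i (suc j)) (t ℚ.* d) ⟩
  ∣ expSum i a ℚ.* expSum n b ℚ.- trapezoid a b i (suc j) ∣ ℚ.+ ∣ t ℚ.* d ∣
    ≤⟨ ℚₚ.+-mono-≤ (rectangle-trapezoid ha hb n i (suc j) (subst (ℕ._≤ n) (sym (ℕₚ.+-suc i j)) i+j≤n))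
         (ℚₚ.≤-trans (ℚₚ.≤-reflexive (ℚₚ.∣p*q∣≡∣p∣*∣q∣ t d))
           (*-mono (ℚₚ.0≤∣p∣ t) (ℚₚ.≤-trans (ℚₚ.0≤∣p∣ d) d≤) (expTerm-bound i ha) d≤)) ⟩
  (expSum i α ℚ.* expSum n β ℚ.- trapezoid α β i (suc j)) ℚ.+ expTerm i α ℚ.* (expSum n β ℚ.- expSum (suc j) β)
    ≡⟨ sym (split (expSum i α) (expTerm i α) (expSum n β) (trapezoid α β i (suc j)) (expSum (suc j) β)) ⟩
  expSum (suc i) α ℚ.* expSum n β ℚ.- trapezoid α β (suc i) j ∎
  where
  open ℚₚ.≤-Reasoning
  t = expTerm i a
  d = expSum n b ℚ.- expSum (suc j) b
  d≤ : ∣ d ∣ ℚ.≤ expSum n β ℚ.- expSum (suc j) β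
  d≤ = expSum-tail hb (ℕₚ.≤⇒≤′ (ℕₚ.≤-trans (ℕ.s≤s (ℕₚ.m≤n+m j i)) i+j≤n))
  split : ∀ x t y z w → (x ℚ.+ t) ℚ.* y ℚ.- (z ℚ.+ t ℚ.* w) ≡ (x ℚ.* y ℚ.- z) ℚ.+ t ℚ.* (y ℚ.- w)
  split = solve 5 (λ x t y z w → (x :+ t) :* y :- (z :+ t :* w) := (x :* y :- z) :+ t :* (y :- w)) refl

module _ {α β} (hα : 0ℚ ℚ.≤ α) (hβ : 0ℚ ℚ.≤ β) where

  expSum-nonneg : ∀ n → 0ℚ ℚ.≤ expSum n β
  expSum-nonneg zero    = ℚₚ.≤-refl
  expSum-nonneg (suc n) = ℚₚ.+-mono-≤ (expSum-nonneg n) (expTerm-nonneg n hβ)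

  expSum-mono : ∀ {m n} → m ℕ.≤′ n → expSum m β ℚ.≤ expSum n β
  expSum-mono ℕ.≤′-refl = ℚₚ.≤-refl
  expSum-mono {m} (ℕ.≤′-step {n} h) = ℚₚ.≤-trans (ℚₚ.≤-reflexive (sym (ℚₚ.+-identityʳ _)))
    (ℚₚ.+-mono-≤ (expSum-mono h) (expTerm-nonneg n hβ))

  rectangle≤trapezoid : ∀ {n} i j → n ℕ.≤ suc j → expSum i α ℚ.* expSum n β ℚ.≤ trapezoid α β i j
  rectangle≤trapezoid {n} zero    j h = ℚₚ.≤-reflexive (ℚₚ.*-zeroˡ (expSum n β))
  rectangle≤trapezoid {n} (suc i) j h = ℚₚ.≤-trans (ℚₚ.≤-reflexive (ℚₚ.*-distribʳ-+ (expSum n β) (expSum i α) (expTerm i α)))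
    (ℚₚ.+-mono-≤ (rectangle≤trapezoid i (suc j) (ℕₚ.m≤n⇒m≤1+n h))
      (ℚₚ.*-monoˡ-≤-nonNeg (expTerm i α) {{nn (expTerm-nonneg i hα)}} (expSum-mono (ℕₚ.≤⇒≤′ h))))

  trapezoid-mono : ∀ d i j → trapezoid α β i (d ℕ.+ j) ℚ.≤ trapezoid α β (d ℕ.+ i) j
  trapezoid-mono zero    i j = ℚₚ.≤-refl
  trapezoid-mono (suc d) i j = begin
    trapezoid α β i (suc d ℕ.+ j)        ≡⟨ cong (trapezoid α β i) (sym (ℕₚ.+-suc d j)) ⟩
    trapezoid α β i (d ℕ.+ suc j)        ≤⟨ trapezoid-mono d i (suc j) ⟩
    trapezoid α β (d ℕ.+ i) (suc j)      ≡⟨ sym (ℚₚ.+-identityʳ _) ⟩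
    trapezoid α β (d ℕ.+ i) (suc j) ℚ.+ 0ℚ ≤⟨ ℚₚ.+-monoʳ-≤ (trapezoid α β (d ℕ.+ i) (suc j)) (*-nonneg (expTerm-nonneg (d ℕ.+ i) hα) (expSum-nonneg (suc j))) ⟩
    trapezoid α β (suc d ℕ.+ i) j        ∎
    where open ℚₚ.≤-Reasoning

  -- All terms are nonnegative, and the square of degrees below n lies in the triangle of total
  -- degree below 2n.
  expSum-*-≤ : ∀ n → expSum n α ℚ.* expSum n β ℚ.≤ expSum (n ℕ.+ n) (α ℚ.+ β)
  expSum-*-≤ n = begin
    expSum n α ℚ.* expSum n β         ≤⟨ rectangle≤trapezoid n n (ℕₚ.n≤1+n n) ⟩
    trapezoid α β n n                 ≡⟨ cong (trapezoid α β n) (sym (ℕₚ.+-identityʳ n)) ⟩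
    trapezoid α β n (n ℕ.+ 0)         ≤⟨ trapezoid-mono n n 0 ⟩
    trapezoid α β (n ℕ.+ n) 0         ≡⟨ sym (expSum-+ α β (n ℕ.+ n)) ⟩
    expSum (n ℕ.+ n) (α ℚ.+ β)        ∎
    where open ℚₚ.≤-Reasoning

-- Square minus triangle, enlarged to the triangle of size 2n, is a stretch of the single series for
-- exp (α + β); its Cauchy property then controls the error uniformly in a and b.
expSum-*-error : ∀ {a b α β} → ∣ a ∣ ℚ.≤ α → ∣ b ∣ ℚ.≤ β → ∀ n →
  ∣ expSum n a ℚ.* expSum n b ℚ.- expSum n (a ℚ.+ b) ∣ ℚ.≤ ∣ expSum (n ℕ.+ n) (α ℚ.+ β) ℚ.- expSum n (α ℚ.+ β) ∣
expSum-*-error {a} {b} {α} {β} ha hb n = begin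
  ∣ expSum n a ℚ.* expSum n b ℚ.- expSum n (a ℚ.+ b) ∣          ≡⟨ cong (λ z → ∣ expSum n a ℚ.* expSum n b ℚ.- z ∣) (expSum-+ a b n) ⟩
  ∣ expSum n a ℚ.* expSum n b ℚ.- trapezoid a b n 0 ∣           ≤⟨ rectangle-trapezoid ha hb n n 0 (ℕₚ.≤-reflexive (ℕₚ.+-identityʳ n)) ⟩
  expSum n α ℚ.* expSum n β ℚ.- trapezoid α β n 0               ≡⟨ cong (λ z → expSum n α ℚ.* expSum n β ℚ.- z) (sym (expSum-+ α β n)) ⟩
  expSum n α ℚ.* expSum n β ℚ.- expSum n (α ℚ.+ β)              ≤⟨ ℚₚ.+-monoˡ-≤ (ℚ.- expSum n (α ℚ.+ β)) (expSum-*-≤ (ℚₚ.≤-trans (ℚₚ.0≤∣p∣ a) ha) (ℚₚ.≤-trans (ℚₚ.0≤∣p∣ b) hb) n) ⟩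
  expSum (n ℕ.+ n) (α ℚ.+ β) ℚ.- expSum n (α ℚ.+ β)             ≤⟨ p≤∣p∣ _ ⟩
  ∣ expSum (n ℕ.+ n) (α ℚ.+ β) ℚ.- expSum n (α ℚ.+ β) ∣         ∎
  where open ℚₚ.≤-Reasoning

close⇒≼ : ∀ {x y} → (∀ ε → 0ℚ ℚ.< ε → ∃ λ N → ∀ n → N ℕ.≤ n → ∣ seq x n ℚ.- seq y n ∣ ℚ.≤ ε) → x ≼ y
close⇒≼ {x} {y} h = mk≼ λ ε ε>0 → proj₁ (h ε ε>0) , λ n n≥ → ℚₚ.≤-trans
  (ℚₚ.≤-reflexive (solve 2 (λ x y → x := y :+ (x :- y)) refl (seq x n) (seq y n)))
  (ℚₚ.+-monoʳ-≤ (seq y n) (ℚₚ.≤-trans (p≤∣p∣ _) (proj₂ (h ε ε>0) n n≥)))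

exp-*-close : ∀ x y ε → 0ℚ ℚ.< ε →
  ∃ λ N → ∀ n → N ℕ.≤ n → ∣ seq (exp x * exp y) n ℚ.- seq (exp (x + y)) n ∣ ℚ.≤ ε
exp-*-close x y ε ε>0 = go (cauchy⇒bounded {seq x} (cauchy x)) (cauchy⇒bounded {seq y} (cauchy y))
  where
  go : EventuallyBounded (seq x) → EventuallyBounded (seq y) →
       ∃ λ N → ∀ n → N ℕ.≤ n → ∣ seq (exp x * exp y) n ℚ.- seq (exp (x + y)) n ∣ ℚ.≤ ε
  go (k , N₁ , bx) (l , N₂ , by) = N₁ ℕ.⊔ N₂ ℕ.⊔ N₃ , λ n n≥ →
    let h₁ = ℕₚ.m⊔n≤o⇒m≤o (N₁ ℕ.⊔ N₂) N₃ n≥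
        h₃ = ℕₚ.m⊔n≤o⇒n≤o (N₁ ℕ.⊔ N₂) N₃ n≥
    in ℚₚ.≤-trans
      (expSum-*-error {seq x n} {seq y n} {ν (suc k)} {ν (suc l)}
        (bx n (ℕₚ.m⊔n≤o⇒m≤o N₁ N₂ h₁)) (by n (ℕₚ.m⊔n≤o⇒n≤o N₁ N₂ h₁)) n)
      (proj₂ converges (n ℕ.+ n) n (ℕₚ.≤-trans h₃ (ℕₚ.m≤m+n n n)) h₃)
    where
    converges = cauchy (exp (fromℚ (ν (suc k) ℚ.+ ν (suc l)))) ε ε>0
    N₃ = proj₁ converges

exp-*-≼ : ∀ x y → exp x * exp y ≼ exp (x + y)
exp-*-≼ x y = close⇒≼ (exp-*-close x y)

exp-+-≼ : ∀ x y → exp (x + y) ≼ exp x * exp y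
exp-+-≼ x y = close⇒≼ λ ε ε>0 → proj₁ (exp-*-close x y ε ε>0) , λ n n≥ →
  ℚₚ.≤-trans (ℚₚ.≤-reflexive (∣-∣-sym (seq (exp (x + y)) n) (seq (exp x * exp y) n))) (proj₂ (exp-*-close x y ε ε>0) n n≥)

exp-cong : ∀ {x y} → x ≐ y → exp x ≐ exp y
exp-cong h = pointwise λ k → cong (expSum k) (at h k)

expSum-0 : ∀ n → expSum (suc n) 0ℚ ≡ 1ℚ
expSum-0 zero    = refl
expSum-0 (suc n) = trans (cong₂ ℚ._+_ (expSum-0 n) (trans (cong (expTerm n 0ℚ ℚ.*_) (ℚₚ.*-zeroˡ (+ 1 / suc n))) (ℚₚ.*-zeroʳ (expTerm n 0ℚ)))) refl

exp-0-≼ : exp 0ℝ ≼ 1ℝ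
exp-0-≼ = mk≼ λ ε ε>0 → 1 , λ where
  (suc n) _ → ℚₚ.≤-trans (ℚₚ.≤-reflexive (expSum-0 n)) (p≤p+ε ε>0)

-- Partial sums at negative arguments can be negative; writing exp x as the square of exp (x/2)
-- settles the sign.
exp-nonneg : ∀ x → 0ℝ ≼ exp x
exp-nonneg x =
  0ℝ                                          ≼⟨ 0≼x*x (exp (fromℚ ½ * x)) ⟩
  exp (fromℚ ½ * x) * exp (fromℚ ½ * x)       ≼⟨ exp-*-≼ (fromℚ ½ * x) (fromℚ ½ * x) ⟩
  exp (fromℚ ½ * x + fromℚ ½ * x)             ≐⟨ exp-cong (pointwise λ k → solve 1 (λ x → con ½ :* x :+ con ½ :* x := x) refl (seq x k)) ⟩
  exp x                                       ■

module _ {x : ℚ} (x≥-1 : ℚ.- 1ℚ ℚ.≤ x) where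

  private
    pair : ∀ k → 0ℚ ℚ.≤ expTerm k x → 0ℚ ℚ.≤ expTerm k x ℚ.+ expTerm (suc k) x
    pair k h = begin
      0ℚ                                                        ≤⟨ *-nonneg h (ℚₚ.+-mono-≤ (0≤- (unitFraction≤1 k)) (*-nonneg (0≤- x≥-1) (ℚₚ.<⇒≤ (ℚ-pos k)))) ⟩
      t ℚ.* ((1ℚ ℚ.- r) ℚ.+ (x ℚ.- ℚ.- 1ℚ) ℚ.* r)               ≡⟨ solve 3 (λ t r x → t :* ((con 1ℚ :- r) :+ (x :- :- con 1ℚ) :* r) := t :+ t :* (x :* r)) refl t r x ⟩
      t ℚ.+ t ℚ.* (x ℚ.* r)                                     ∎
      where
      open ℚₚ.≤-Reasoning
      t = expTerm k x
      r = + 1 / suc k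
      0≤- : ∀ {p q} → p ℚ.≤ q → 0ℚ ℚ.≤ q ℚ.- p
      0≤- {p} {q} p≤q = ℚₚ.≤-trans (ℚₚ.≤-reflexive (sym (ℚₚ.+-inverseʳ p))) (ℚₚ.+-monoˡ-≤ (ℚ.- p) p≤q)

    +2 : ∀ k → 0ℚ ℚ.≤ expTerm k x → 0ℚ ℚ.≤ expTerm (suc (suc k)) x
    +2 k h = ℚₚ.≤-trans (*-nonneg h (*-nonneg (0≤p*p x) (*-nonneg (ℚₚ.<⇒≤ (ℚ-pos k)) (ℚₚ.<⇒≤ (ℚ-pos (suc k))))))
      (ℚₚ.≤-reflexive (solve 4 (λ t x r s → t :* ((x :* x) :* (r :* s)) := t :* (x :* r) :* (x :* s)) refl
        (expTerm k x) x (+ 1 / suc k) (+ 1 / suc (suc k))))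

    grow : ∀ {p q} → 0ℚ ℚ.≤ q → p ℚ.≤ p ℚ.+ q
    grow {p} h = ℚₚ.≤-trans (ℚₚ.≤-reflexive (sym (ℚₚ.+-identityʳ p))) (ℚₚ.+-monoʳ-≤ p h)

    -- Adding two terms at a time, x ≥ −1 makes each pair nonnegative.
    expSum-above : ∀ {p} n k → 0ℚ ℚ.≤ expTerm k x → p ℚ.≤ expSum k x → p ℚ.≤ expSum (n ℕ.+ k) x
    expSum-above zero          k h p≤ = p≤
    expSum-above (suc zero)    k h p≤ = ℚₚ.≤-trans p≤ (grow h)
    expSum-above {p} (suc (suc n)) k h p≤ = subst (λ m → p ℚ.≤ expSum m x)
      (trans (ℕₚ.+-suc n (suc k)) (cong suc (ℕₚ.+-suc n k)))
      (expSum-above n (suc (suc k)) (+2 k h)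
        (ℚₚ.≤-trans p≤ (ℚₚ.≤-trans (grow (pair k h)) (ℚₚ.≤-reflexive (sym (ℚₚ.+-assoc (expSum k x) (expTerm k x) (expTerm (suc k) x)))))))

  1+x≤expSum : ∀ n → 1ℚ ℚ.+ x ℚ.≤ expSum (n ℕ.+ 2) x
  1+x≤expSum n = expSum-above n 2 (+2 0 (ℚₚ.≤ᵇ⇒≤ {0ℚ} {1ℚ} _))
    (ℚₚ.≤-reflexive (solve 1 (λ x → con 1ℚ :+ x := (con 0ℚ :+ con 1ℚ) :+ con 1ℚ :* (x :* con 1ℚ)) refl x))

-- Entries of a nonnegative real may be negative, but eventually they are at least -1, which is all
-- that `1+x≤expSum` asks.
1+x≼exp : ∀ {x} → 0ℝ ≼ x → 1ℝ + x ≼ exp x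
1+x≼exp {x} (mk≼ h) = mk≼ go
  where
  go : 1ℝ + x ≤ exp x
  go ε ε>0 with h 1ℚ (ℚₚ.positive⁻¹ 1ℚ)
  ... | N , p = N ℕ.⊔ 2 , λ n n≥ → ℚₚ.≤-trans
    (subst (λ m → 1ℚ ℚ.+ seq x n ℚ.≤ expSum m (seq x n)) (ℕₚ.m∸n+n≡m (ℕₚ.m⊔n≤o⇒n≤o N 2 n≥))
      (1+x≤expSum (x≥-1 (p n (ℕₚ.m⊔n≤o⇒m≤o N 2 n≥))) (n ℕ.∸ 2)))
    (p≤p+ε ε>0)
    where
    x≥-1 : ∀ {p} → 0ℚ ℚ.≤ p ℚ.+ 1ℚ → ℚ.- 1ℚ ℚ.≤ p
    x≥-1 {p} h = ℚₚ.≤-trans (ℚₚ.+-monoˡ-≤ (ℚ.- 1ℚ) h)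
      (ℚₚ.≤-reflexive (solve 1 (λ p → p :+ con 1ℚ :- con 1ℚ := p) refl p))

exp-inverse : ∀ x → exp (- x) * exp x ≼ 1ℝ
exp-inverse x =
  exp (- x) * exp x    ≼⟨ exp-*-≼ (- x) x ⟩
  exp (- x + x)        ≐⟨ exp-cong (pointwise λ k → ℚₚ.+-inverseˡ (seq x k)) ⟩
  exp 0ℝ               ≼⟨ exp-0-≼ ⟩
  1ℝ                   ■

exp-neg≼1 : ∀ {x} → 0ℝ ≼ x → exp (- x) ≼ 1ℝ
exp-neg≼1 {x} h =
  exp (- x)            ≐⟨ pointwise (λ k → sym (ℚₚ.*-identityʳ _)) ⟩
  exp (- x) * 1ℝ       ≼⟨ *-monoˡ-≼ (exp (- x)) (exp-nonneg (- x))
                            (≼-trans (≼-by x h ≐-refl) (1+x≼exp h)) ⟩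
  exp (- x) * exp x    ≼⟨ exp-inverse x ⟩
  1ℝ                   ■

infixr 8 _^_

_^_ : ℝ → ℕ → ℝ
x ^ zero  = 1ℝ
x ^ suc m = x * x ^ m

1≼exp0 : 1ℝ ≼ exp 0ℝ
1≼exp0 = ≼-trans (≐⇒≼ (pointwise λ _ → refl)) (1+x≼exp ≼-refl)

[1+x]^m≼exp : ∀ {x} → 0ℝ ≼ x → ∀ m → (1ℝ + x) ^ m ≼ exp (fromℕ m * x)
[1+x]^m≼exp {x} h zero    = ≼-trans 1≼exp0 (≐⇒≼ (exp-cong (pointwise λ k → sym (ℚₚ.*-zeroˡ (seq x k)))))
[1+x]^m≼exp {x} h (suc m) =
  (1ℝ + x) * (1ℝ + x) ^ m      ≼⟨ *-mono-≼ (0≼+ 0≼1 h) (exp-nonneg _) (1+x≼exp h) ([1+x]^m≼exp h m) ⟩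
  exp x * exp (fromℕ m * x)    ≼⟨ exp-*-≼ x (fromℕ m * x) ⟩
  exp (x + fromℕ m * x)        ≐⟨ exp-cong (pointwise λ k → trans
                                    (solve 2 (λ x m → x :+ m :* x := (con 1ℚ :+ m) :* x) refl (seq x k) (+ m / 1))
                                    (cong (ℚ._* seq x k) (sym (+1/1 m)))) ⟩
  exp (fromℕ (suc m) * x)      ■

-- Sums over orders

-- Packaged to obtain the permutation invariance of finite sums from `sum-permute`.
+-commutativeMonoid : CommutativeMonoid 0ℓ 0ℓ
+-commutativeMonoid = record
  { Carrier = ℝ
  ; _≈_ = _≐_
  ; _∙_ = _+_
  ; ε = 0ℝ
  ; isCommutativeMonoid = record
    { isMonoid = record
      { isSemigroup = record
        { isMagma = record
          { isEquivalence = record { refl = ≐-refl ; sym = ≐-sym ; trans = ≐-trans }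
          ; ∙-cong = +-cong }
        ; assoc = λ x y z → pointwise λ k → ℚₚ.+-assoc (seq x k) (seq y k) (seq z k) }
      ; identity = (λ x → pointwise λ k → ℚₚ.+-identityˡ (seq x k)) , (λ x → pointwise λ k → ℚₚ.+-identityʳ (seq x k)) }
    ; comm = λ x y → pointwise λ k → ℚₚ.+-comm (seq x k) (seq y k) } }

open Sum +-commutativeMonoid using (sum; sum-permute)

∑-tabulate : ∀ {A : Set} n (g : Fin n → A) (f : A → ℝ) → ∑ (tabulate g) f ≐ sum (λ i → f (g i))
∑-tabulate zero    g f = ≐-refl
∑-tabulate (suc n) g f = +-cong ≐-refl (∑-tabulate n (g ∘ suc) f)

∑-permute : ∀ {n} (f : Fin n → ℝ) (ρ : Permutation′ n) → ∑ (allFin n) (λ i → f (ρ ⟨$⟩ʳ i)) ≐ ∑ (allFin n) f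
∑-permute {n} f ρ = ≐-trans (∑-tabulate n _ _)
  (≐-trans (≐-sym (sum-permute f ρ)) (≐-sym (∑-tabulate n _ _)))

insert-∘ₚ : ∀ {n} r (σ : Permutation′ n) (ρ : Permutation′ (suc n)) →
            insert zero r σ ∘ₚ ρ ≈ insert zero (ρ ⟨$⟩ʳ r) (σ ∘ₚ remove r ρ)
insert-∘ₚ r σ ρ zero    = refl
insert-∘ₚ r σ ρ (suc k) = trans (cong (ρ ⟨$⟩ʳ_) (insert-punchIn zero r σ k))
  (trans (punchIn-permute ρ r (σ ⟨$⟩ʳ k)) (sym (insert-punchIn zero (ρ ⟨$⟩ʳ r) (σ ∘ₚ remove r ρ) k)))

insert-cong : ∀ {n} r {σ τ : Permutation′ n} → σ ≈ τ → insert zero r σ ≈ insert zero r τ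
insert-cong r h zero = refl
insert-cong r {σ} {τ} h (suc k) = trans (insert-punchIn zero r σ k)
  (trans (cong (punchIn r) (h k)) (sym (insert-punchIn zero r τ k)))

-- `ρ` acts on ranks. In the recursive enumeration it sends the rank r of element zero to its image,
-- handled by `∑-permute`, and changes the relative order of the other elements by `remove r ρ`,
-- handled by induction. The reordered list agrees with the old one only up to `≈`, hence the
-- congruence hypothesis.
∑-orders-∘ₚ : ∀ n (f : Order n → ℝ) → (∀ {π ρ} → π ≈ ρ → f π ≐ f ρ) → (ρ : Permutation′ n) →
              ∑ (orders n) (λ π → f (π ∘ₚ ρ)) ≐ ∑ (orders n) f
∑-orders-∘ₚ zero    f f-cong ρ = +-cong (f-cong λ ()) ≐-refl
∑-orders-∘ₚ (suc n) f f-cong ρ =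
  ≐-trans (∑-cartesianProductWith (insert zero) (allFin (suc n)) (orders n) _)
  (≐-trans (∑-cong (allFin (suc n)) λ r →
      ≐-trans (∑-cong (orders n) λ σ → f-cong (insert-∘ₚ r σ ρ))
        (∑-orders-∘ₚ n (λ σ → f (insert zero (ρ ⟨$⟩ʳ r) σ)) (λ h → f-cong (insert-cong (ρ ⟨$⟩ʳ r) h)) (remove r ρ)))
  (≐-trans (∑-permute (λ r → ∑ (orders n) (λ σ → f (insert zero r σ))) ρ)
    (≐-sym (∑-cartesianProductWith (insert zero) (allFin (suc n)) (orders n) f))))

-- Moving one rank to the front

moveToFront : ∀ {n} → Fin (suc n) → Permutation′ (suc n)
moveToFront k = insert k zero id

moveToFront-at : ∀ {n} (k : Fin (suc n)) → moveToFront k ⟨$⟩ʳ k ≡ zero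
moveToFront-at k with k Fin.≟ k
... | yes _   = refl
... | no  k≢k = contradiction refl k≢k

moveToFront-off : ∀ {n} {k r : Fin (suc n)} (k≢r : k ≢ r) → moveToFront k ⟨$⟩ʳ r ≡ suc (punchOut k≢r)
moveToFront-off {k = k} {r} k≢r = trans (cong (moveToFront k ⟨$⟩ʳ_) (sym (Finₚ.punchIn-punchOut k≢r)))
  (insert-punchIn k zero id (punchOut k≢r))

moveToFront-≤ : ∀ {n} {k r s : Fin (suc n)} → k ≢ r → k ≢ s →
                r Fin.≤ s → moveToFront k ⟨$⟩ʳ r Fin.≤ moveToFront k ⟨$⟩ʳ s
moveToFront-≤ {k = k} k≢r k≢s r≤s
  rewrite moveToFront-off k≢r | moveToFront-off k≢s = ℕ.s≤s (Finₚ.punchOut-mono-≤ k≢r k≢s r≤s)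

moveToFront-cancel-≤ : ∀ {n} {k r s : Fin (suc n)} → k ≢ r → k ≢ s →
                       moveToFront k ⟨$⟩ʳ r Fin.≤ moveToFront k ⟨$⟩ʳ s → r Fin.≤ s
moveToFront-cancel-≤ {k = k} k≢r k≢s h
  rewrite moveToFront-off k≢r | moveToFront-off k≢s = Finₚ.punchOut-cancel-≤ k≢r k≢s (ℕ.s≤s⁻¹ h)

-- Away from rank k the map `moveToFront k` is increasing and reflects the order.
moveToFront-answer : ∀ {n} (π : Order (suc n)) k i j → k ≢ π ⟨$⟩ʳ i → k ≢ π ⟨$⟩ʳ j →
                     does (precedes? π i j) ≡ does (precedes? (π ∘ₚ moveToFront k) i j)
moveToFront-answer π k i j k≢i k≢j = does-⇔ (mk⇔
    (λ i<j → ℕₚ.≰⇒> λ j≤i → ℕₚ.<⇒≱ i<j (moveToFront-cancel-≤ k≢j k≢i j≤i))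
    (λ i<j → ℕₚ.≰⇒> λ j≤i → ℕₚ.<⇒≱ i<j (moveToFront-≤ k≢j k≢i j≤i)))
  (precedes? π i j) (precedes? (π ∘ₚ moveToFront k) i j)

-- The element of rank `suc k` is not first in `π`, since its rank is a successor; every other
-- element comes after it in the moved order.
moveToFront-min : ∀ {n} (π : Order (suc n)) k i → ¬ IsMin π i ⊎ ¬ IsMin (π ∘ₚ moveToFront (suc k)) i
moveToFront-min {suc n} π k i = go (suc k Fin.≟ π ⟨$⟩ʳ i)
  where
  go : Dec (suc k ≡ π ⟨$⟩ʳ i) → ¬ IsMin π i ⊎ ¬ IsMin (π ∘ₚ moveToFront (suc k)) i
  go (yes eq) = inj₁ λ min → ℕₚ.n≮0
      (subst (Fin.toℕ (suc k) ℕ.≤_) (cong Fin.toℕ (inverseʳ π {zero})) (subst (λ r → r Fin.≤ π ⟨$⟩ʳ (π ⟨$⟩ˡ zero)) (sym eq) (min (π ⟨$⟩ˡ zero))))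
  go (no neq) = inj₂ λ min → ℕₚ.n≮0 (subst₂ (λ r s → r Fin.≤ s) (moveToFront-off neq)
        (trans (cong (moveToFront (suc k) ⟨$⟩ʳ_) (inverseʳ π)) (moveToFront-at (suc k))) (min (π ⟨$⟩ˡ suc k)))

successOn-cong : ∀ {n q} γ (A : Alg n q) {π ρ : Order n} → π ≈ ρ → successOn γ π A ≐ successOn γ ρ A
successOn-cong γ (output i) {π} {ρ} h = pointwise λ k → cong (λ c → seq (if c then 1ℝ else 0ℝ) k)
  (does-⇔ (mk⇔ (λ m j → subst₂ Fin._≤_ (h i) (h j) (m j)) (λ m j → subst₂ Fin._≤_ (sym (h i)) (sym (h j)) (m j)))
    (isMin? π i) (isMin? ρ i))
successOn-cong γ (query i j i≢j next) {π} {ρ} h = ≐-trans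
  (+-cong (*-cong ≐-refl (successOn-cong γ (next c) h)) (*-cong ≐-refl (successOn-cong γ (next (not c)) h)))
  (pointwise λ k → cong (λ b → seq ((fromℚ ½ + fromℚ ½ * γ) * successOn γ ρ (next b) + (fromℚ ½ - fromℚ ½ * γ) * successOn γ ρ (next (not b))) k)
    (does-⇔ (mk⇔ (subst₂ Fin._<_ (h i) (h j)) (subst₂ Fin._<_ (sym (h i)) (sym (h j)))) (precedes? π i j) (precedes? ρ i j)))
  where c = does (precedes? π i j)
successOn-cong γ (random {k = k} D next) h = ∑-cong (allFin k) λ i → *-cong ≐-refl (successOn-cong γ (next i) h)

-- Change of measure

boundedBelow : ∀ x → ∃ λ B → 0ℝ ≼ x + fromℕ B
boundedBelow x = go (cauchy⇒bounded {seq x} (cauchy x))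
  where
  bound : ∀ {u B} → ∣ u ∣ ℚ.≤ B → 0ℚ ℚ.≤ u ℚ.+ B
  bound {u} {B} h′ = begin
    0ℚ                ≡⟨ sym (ℚₚ.+-inverseʳ u) ⟩
    u ℚ.+ (ℚ.- u)     ≤⟨ ℚₚ.+-monoʳ-≤ u (ℚₚ.≤-trans (p≤∣p∣ (ℚ.- u)) (ℚₚ.≤-reflexive (ℚₚ.∣-p∣≡∣p∣ u))) ⟩
    u ℚ.+ ∣ u ∣       ≤⟨ ℚₚ.+-monoʳ-≤ u h′ ⟩
    u ℚ.+ B           ∎
    where open ℚₚ.≤-Reasoning
  go : EventuallyBounded (seq x) → ∃ λ B → 0ℝ ≼ x + fromℕ B
  go (k , N , h) = suc k , mk≼ λ ε ε>0 → N , λ n n≥ → ℚₚ.≤-trans (bound {seq x n} {+ suc k / 1} (h n n≥)) (p≤p+ε ε>0)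

expectation : ∀ {k} → Distribution k → (Fin k → ℝ) → ℝ
expectation {k} D X = ∑ (allFin k) λ i → prob D i * X i

-- The total probability S equals 1 only in the limit, and K has no known sign. With a shift B such
-- that B and K + B are nonnegative, K - KS = (K + B)(1 - S) + B(S - 1) is a sum of nonnegative
-- parts, from S ≤ 1 and S ≥ 1 respectively.
expectation-≼ : ∀ {k} (D : Distribution k) {X : Fin k → ℝ} {K} → (∀ i → X i ≼ K) → expectation D X ≼ K
expectation-≼ {k} D {X} {K} h = go (boundedBelow K)
  where
  S = ∑ (allFin k) (prob D)
  go : (∃ λ B → 0ℝ ≼ K + fromℕ B) → expectation D X ≼ K
  go (B , 0≼K+B) =
    ∑ (allFin k) (λ i → prob D i * X i)  ≼⟨ ∑-mono (allFin k) (λ i → *-monoˡ-≼ (prob D i) (mk≼ (nonneg D i)) (h i)) ⟩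
    ∑ (allFin k) (λ i → prob D i * K)    ≐⟨ ∑-cong (allFin k) (λ i → pointwise λ j → ℚₚ.*-comm (seq (prob D i) j) (seq K j)) ⟩
    ∑ (allFin k) (λ i → K * prob D i)    ≐⟨ ∑-*ˡ (allFin k) K (prob D) ⟩
    K * S                                ≼⟨ ≼-by ((K + fromℕ B) * (1ℝ - S) + fromℕ B * (S - 1ℝ))
                                              (0≼+ (0≼* 0≼K+B (≼⇒0≼- (mk≼ (proj₁ (sums-to-1 D)))))
                                                   (0≼* (0≼fromℕ B) (≼⇒0≼- (mk≼ (proj₂ (sums-to-1 D))))))
                                              (pointwise λ j → solve 3 (λ K B S → K := K :* S :+ ((K :+ B) :* (con 1ℚ :- S) :+ B :* (S :- con 1ℚ)))
                                                refl (seq K j) (+ B / 1) (seq S j)) ⟩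
    K                                    ■

0≼expectation : ∀ {k} (D : Distribution k) {X : Fin k → ℝ} → (∀ i → 0ℝ ≼ X i) → 0ℝ ≼ expectation D X
0≼expectation {k} D h = ≼-trans (≐⇒≼ (≐-sym (∑-zero (allFin k))))
  (∑-mono (allFin k) λ i → 0≼* (mk≼ (nonneg D i)) (h i))

module Noise (γ : ℝ) (0≼γ : 0ℝ ≼ γ) (γ≼¼ : γ ≼ fromℚ (+ 1 / 4)) where

  p p̄ growth G f₁ f₂ : ℝ
  p = fromℚ ½ + fromℚ ½ * γ
  p̄ = fromℚ ½ - fromℚ ½ * γ
  growth = fromℕ 5 * (γ * γ)
  G = 1ℝ + growth

  -- Polynomial upper bounds for p² / p̄ and p̄² / p whose sum is G.
  f₁ = fromℚ ½ * (1ℝ + fromℕ 3 * γ + fromℕ 6 * (γ * γ))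
  f₂ = fromℚ ½ * (1ℝ - fromℕ 3 * γ + fromℕ 4 * (γ * γ))

  private
    h = fromℚ (+ 1 / 4) - γ

    0≼h : 0ℝ ≼ h
    0≼h = ≼⇒0≼- γ≼¼

    0≼¼ : 0ℝ ≼ fromℚ (+ 1 / 4)
    0≼¼ = fromℚ-mono (ℚₚ.≤ᵇ⇒≤ {0ℚ} {+ 1 / 4} _)

    0≼1-3γ : 0ℝ ≼ 1ℝ - fromℕ 3 * γ
    0≼1-3γ = ≼-trans (0≼+ (0≼* (0≼fromℕ 3) 0≼h) 0≼¼)
      (≐⇒≼ (pointwise λ k → solve 1 (λ g → con (+ 3 / 1) :* (con (+ 1 / 4) :- g) :+ con (+ 1 / 4) := con 1ℚ :- con (+ 3 / 1) :* g) refl (seq γ k)))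

  0≼growth : 0ℝ ≼ growth
  0≼growth = 0≼* (0≼fromℕ 5) (0≼x*x γ)

  0≼p : 0ℝ ≼ p
  0≼p = 0≼+ 0≼½ (0≼* 0≼½ 0≼γ)

  0≼p̄ : 0ℝ ≼ p̄
  0≼p̄ = ≼-trans (0≼+ (0≼* 0≼½ 0≼1-3γ) 0≼γ)
    (≐⇒≼ (pointwise λ k → solve 1 (λ g → con ½ :* (con 1ℚ :- con (+ 3 / 1) :* g) :+ g := con ½ :- con ½ :* g) refl (seq γ k)))

  0≼f₁ : 0ℝ ≼ f₁
  0≼f₁ = 0≼* 0≼½ (0≼+ (0≼+ 0≼1 (0≼* (0≼fromℕ 3) 0≼γ)) (0≼* (0≼fromℕ 6) (0≼x*x γ)))

  0≼f₂ : 0ℝ ≼ f₂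
  0≼f₂ = 0≼* 0≼½ (0≼+ 0≼1-3γ (0≼* (0≼fromℕ 4) (0≼x*x γ)))

  -- Long division gives p²/p̄ = ½(1 + 3γ + 4γ²/(1 - γ)), and 4/(1 - γ) ≤ 6 as long as γ ≤ 1/3.
  p²≼p̄f₁ : p * p ≼ p̄ * f₁
  p²≼p̄f₁ = ≼-by (fromℚ ½ * ((γ * γ) * (1ℝ - fromℕ 3 * γ))) (0≼* 0≼½ (0≼* (0≼x*x γ) 0≼1-3γ))
    (pointwise λ k → solve 1 (λ g →
      (con ½ :- con ½ :* g) :* (con ½ :* (con 1ℚ :+ con (+ 3 / 1) :* g :+ con (+ 6 / 1) :* (g :* g)))
      := (con ½ :+ con ½ :* g) :* (con ½ :+ con ½ :* g) :+ con ½ :* ((g :* g) :* (con 1ℚ :- con (+ 3 / 1) :* g))) refl (seq γ k))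

  -- Here the quotient is ½(1 - 3γ + 4γ²/(1 + γ)), and the last denominator is at least 1.
  p̄²≼pf₂ : p̄ * p̄ ≼ p * f₂
  p̄²≼pf₂ = ≼-by ((γ * γ) * γ) (0≼* (0≼x*x γ) 0≼γ)
    (pointwise λ k → solve 1 (λ g →
      (con ½ :+ con ½ :* g) :* (con ½ :* (con 1ℚ :- con (+ 3 / 1) :* g :+ con (+ 4 / 1) :* (g :* g)))
      := (con ½ :- con ½ :* g) :* (con ½ :- con ½ :* g) :+ (g :* g) :* g) refl (seq γ k))

  0≼G^ : ∀ m → 0ℝ ≼ G ^ m
  0≼G^ zero    = 0≼1
  0≼G^ (suc m) = 0≼* (0≼+ 0≼1 0≼growth) (0≼G^ m)

  1≼G^ : ∀ m → 1ℝ ≼ G ^ m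
  1≼G^ zero    = ≼-refl
  1≼G^ (suc m) = ≼-trans (1≼G^ m) (≼-by (growth * G ^ m) (0≼* 0≼growth (0≼G^ m))
    (pointwise λ k → solve 2 (λ g e → (con 1ℚ :+ g) :* e := e :+ g :* e) refl (seq growth k) (seq (G ^ m) k)))

  mix : Bool → (Bool → ℝ) → ℝ
  mix c v = p * v c + p̄ * v (not c)

  mix-≼ : ∀ c {v : Bool → ℝ} {K} → (∀ β → v β ≼ K) → mix c v ≼ K
  mix-≼ c {v} {K} h = ≼-trans (+-mono-≼ (*-monoˡ-≼ p 0≼p (h c)) (*-monoˡ-≼ p̄ 0≼p̄ (h (not c))))
    (≐⇒≼ (pointwise λ k → solve 2 (λ g K → (con ½ :+ con ½ :* g) :* K :+ (con ½ :- con ½ :* g) :* K := K) refl (seq γ k) (seq K k)))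

  0≼mix : ∀ c {v : Bool → ℝ} → (∀ β → 0ℝ ≼ v β) → 0ℝ ≼ mix c v
  0≼mix c h = 0≼+ (0≼* 0≼p (h c)) (0≼* 0≼p̄ (h (not c)))

  indicator≼1 : ∀ c → (if c then 1ℝ else 0ℝ) ≼ 1ℝ
  indicator≼1 true  = ≼-refl
  indicator≼1 false = 0≼1

  success≼1 : ∀ {n q} (π : Order n) (A : Alg n q) → successOn γ π A ≼ 1ℝ
  success≼1 π (output i)          = indicator≼1 (does (isMin? π i))
  success≼1 π (query i j _ next)  = mix-≼ (does (precedes? π i j)) {λ β → successOn γ π (next β)} λ β → success≼1 π (next β)
  success≼1 π (random D next)     = expectation-≼ D λ i → success≼1 π (next i)

  module Cost {n} (π : Order n) (charge : Fin n → Fin n → ℝ) (0≼charge : ∀ i j → 0ℝ ≼ charge i j) where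

    expectedCost : ∀ {q} → Alg n q → ℝ
    expectedCost (output i)         = 0ℝ
    expectedCost (query i j _ next) = charge i j + mix (does (precedes? π i j)) λ β → expectedCost (next β)
    expectedCost (random D next)    = expectation D λ i → expectedCost (next i)

    0≼expectedCost : ∀ {q} (A : Alg n q) → 0ℝ ≼ expectedCost A
    0≼expectedCost (output i)         = ≼-refl
    0≼expectedCost (query i j _ next) = 0≼+ (0≼charge i j) (0≼mix (does (precedes? π i j)) {λ β → expectedCost (next β)} λ β → 0≼expectedCost (next β))
    0≼expectedCost (random D next)    = 0≼expectation D λ i → 0≼expectedCost (next i)

  module ChangeOfMeasure {n} (π π′ : Order n)
    (charge : Fin n → Fin n → ℝ) (0≼charge : ∀ i j → 0ℝ ≼ charge i j)
    (distinguish : ∀ i j → does (precedes? π i j) ≡ does (precedes? π′ i j) ⊎ 1ℝ ≼ charge i j)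
    (separated : ∀ i → ¬ IsMin π i ⊎ ¬ IsMin π′ i)
    (M : ℕ) (t : ℝ) (0≼t : 0ℝ ≼ t) (t+t≼1 : t + t ≼ 1ℝ) where

    open Cost π charge 0≼charge

    -- a and b are the likelihoods of the transcript so far under π and π′, and
    -- z ≥ a²/b; m of the M allowed distinguishing comparisons are left.  As
    -- M·1[N ≤ M] ≥ M − N, the bound is linear in the expected number w of them.
    lhs : (a b s s′ w : ℝ) → ℝ
    lhs a b s s′ w = fromℕ M * (a * s + b * s′) - (t + t) * (a * w)

    rhs : (m : ℕ) (a b z : ℝ) → ℝ
    rhs m a b z = fromℕ M * (a + b) - (t + t) * (a * fromℕ m) + fromℕ M * (t * t * (z * G ^ m))

    record Weights (a b z : ℝ) : Set where
      constructor weights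
      field
        0≼a : 0ℝ ≼ a
        0≼b : 0ℝ ≼ b
        0≼z : 0ℝ ≼ z
        a²≼bz : a * a ≼ b * z

    -- The factor `f` bounds u²/v for the probabilities u and v of one answer: it is u itself when
    -- both orders agree on the query, and `f₁` or `f₂` when they differ.
    scale : ∀ {a b z u v f} → 0ℝ ≼ u → 0ℝ ≼ v → 0ℝ ≼ f → u * u ≼ v * f →
            Weights a b z → Weights (u * a) (v * b) (f * z)
    scale {a} {b} {z} {u} {v} {f} hu hv hf h (weights ha hb hz hw) = weights (0≼* hu ha) (0≼* hv hb) (0≼* hf hz) (
      (u * a) * (u * a)    ≐⟨ pointwise (λ k → interchange (seq u k) (seq a k) (seq u k) (seq a k)) ⟩
      (u * u) * (a * a)    ≼⟨ *-mono-≼ (0≼x*x u) (0≼* hb hz) h hw ⟩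
      (v * f) * (b * z)    ≐⟨ pointwise (λ k → interchange (seq v k) (seq f k) (seq b k) (seq z k)) ⟩
      (v * b) * (f * z)    ■)
      where
      interchange : ∀ a b c d → (a ℚ.* b) ℚ.* (c ℚ.* d) ≡ (a ℚ.* c) ℚ.* (b ℚ.* d)
      interchange = solve 4 (λ a b c d → (a :* b) :* (c :* d) := (a :* c) :* (b :* d)) refl

    -- Since a ≤ √(bz), this is 2√(b · t²z) ≤ b + t²z; it is proved in squared form to avoid the
    -- roots.
    amgm : ∀ {a b z} → Weights a b z → (t + t) * a ≼ b + t * t * z
    amgm {a} {b} {z} (weights ha hb hz hw) = x²≼y²⇒x≼y (0≼+ hb (0≼* (0≼x*x t) hz)) (
      ((t + t) * a) * ((t + t) * a)          ≐⟨ pointwise (λ k → solve 2 (λ t a → ((t :+ t) :* a) :* ((t :+ t) :* a) := con (+ 4 / 1) :* (t :* t) :* (a :* a)) refl (seq t k) (seq a k)) ⟩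
      fromℕ 4 * (t * t) * (a * a)            ≼⟨ *-monoˡ-≼ (fromℕ 4 * (t * t)) (0≼* (0≼fromℕ 4) (0≼x*x t)) hw ⟩
      fromℕ 4 * (t * t) * (b * z)            ≼⟨ ≼-by ((b - t * t * z) * (b - t * t * z)) (0≼x*x (b - t * t * z))
                                                  (pointwise λ k → solve 3 (λ t b z → (b :+ t :* t :* z) :* (b :+ t :* t :* z)
                                                    := con (+ 4 / 1) :* (t :* t) :* (b :* z) :+ (b :- t :* t :* z) :* (b :- t :* t :* z)) refl (seq t k) (seq b k) (seq z k)) ⟩
      (b + t * t * z) * (b + t * t * z)      ■)

    private
      lhs-same : ∀ a b s₁ s₂ s₁′ s₂′ w₁ w₂ ch → 0ℝ ≼ a → 0ℝ ≼ ch →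
        lhs a b (p * s₁ + p̄ * s₂) (p * s₁′ + p̄ * s₂′) (ch + (p * w₁ + p̄ * w₂)) ≼
        lhs (p * a) (p * b) s₁ s₁′ w₁ + lhs (p̄ * a) (p̄ * b) s₂ s₂′ w₂
      lhs-same a b s₁ s₂ s₁′ s₂′ w₁ w₂ ch ha hch = ≼-by ((t + t) * (a * ch)) (0≼* (0≼+ 0≼t 0≼t) (0≼* ha hch))
        (pointwise λ k → solve 13 (λ M t p p̄ a b s₁ s₂ s₁′ s₂′ w₁ w₂ ch →
          (M :* ((p :* a) :* s₁ :+ (p :* b) :* s₁′) :- (t :+ t) :* ((p :* a) :* w₁)) :+
          (M :* ((p̄ :* a) :* s₂ :+ (p̄ :* b) :* s₂′) :- (t :+ t) :* ((p̄ :* a) :* w₂))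
          := (M :* (a :* (p :* s₁ :+ p̄ :* s₂) :+ b :* (p :* s₁′ :+ p̄ :* s₂′)) :- (t :+ t) :* (a :* (ch :+ (p :* w₁ :+ p̄ :* w₂))))
          :+ (t :+ t) :* (a :* ch)) refl
          (+ M / 1) (seq t k) (seq p k) (seq p̄ k) (seq a k) (seq b k) (seq s₁ k) (seq s₂ k) (seq s₁′ k) (seq s₂′ k) (seq w₁ k) (seq w₂ k) (seq ch k))

      rhs-same : ∀ m a b z → rhs m (p * a) (p * b) (p * z) + rhs m (p̄ * a) (p̄ * b) (p̄ * z) ≐ rhs m a b z
      rhs-same m a b z = pointwise λ k → solve 8 (λ M t g a b z m e →
          (M :* ((con ½ :+ con ½ :* g) :* a :+ (con ½ :+ con ½ :* g) :* b) :- (t :+ t) :* (((con ½ :+ con ½ :* g) :* a) :* m) :+ M :* (t :* t :* (((con ½ :+ con ½ :* g) :* z) :* e))) :+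
          (M :* ((con ½ :- con ½ :* g) :* a :+ (con ½ :- con ½ :* g) :* b) :- (t :+ t) :* (((con ½ :- con ½ :* g) :* a) :* m) :+ M :* (t :* t :* (((con ½ :- con ½ :* g) :* z) :* e)))
          := M :* (a :+ b) :- (t :+ t) :* (a :* m) :+ M :* (t :* t :* (z :* e))) refl
          (+ M / 1) (seq t k) (seq γ k) (seq a k) (seq b k) (seq z k) (+ m / 1) (seq (G ^ m) k)

      -- Under `π′` the two answers exchange their probabilities. One unit of charge is kept, as
      -- -2ta: it pays for lowering the allowance by one.
      lhs-differ : ∀ a b s₁ s₂ s₁′ s₂′ w₁ w₂ ch → 0ℝ ≼ a → 1ℝ ≼ ch →
        lhs a b (p * s₁ + p̄ * s₂) (p * s₂′ + p̄ * s₁′) (ch + (p * w₁ + p̄ * w₂)) ≼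
        lhs (p * a) (p̄ * b) s₁ s₁′ w₁ + lhs (p̄ * a) (p * b) s₂ s₂′ w₂ - (t + t) * a
      lhs-differ a b s₁ s₂ s₁′ s₂′ w₁ w₂ ch ha hch = ≼-by ((t + t) * (a * (ch - 1ℝ))) (0≼* (0≼+ 0≼t 0≼t) (0≼* ha (≼⇒0≼- hch)))
        (pointwise λ k → solve 13 (λ M t p p̄ a b s₁ s₂ s₁′ s₂′ w₁ w₂ ch →
          (M :* ((p :* a) :* s₁ :+ (p̄ :* b) :* s₁′) :- (t :+ t) :* ((p :* a) :* w₁)) :+
          (M :* ((p̄ :* a) :* s₂ :+ (p :* b) :* s₂′) :- (t :+ t) :* ((p̄ :* a) :* w₂)) :- (t :+ t) :* a
          := (M :* (a :* (p :* s₁ :+ p̄ :* s₂) :+ b :* (p :* s₂′ :+ p̄ :* s₁′)) :- (t :+ t) :* (a :* (ch :+ (p :* w₁ :+ p̄ :* w₂))))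
          :+ (t :+ t) :* (a :* (ch :- con 1ℚ))) refl
          (+ M / 1) (seq t k) (seq p k) (seq p̄ k) (seq a k) (seq b k) (seq s₁ k) (seq s₂ k) (seq s₁′ k) (seq s₂′ k) (seq w₁ k) (seq w₂ k) (seq ch k))

      -- The kept -2ta completes -2tam to -2ta(m + 1), and f₁ + f₂ = `G` supplies the additional
      -- power of `G`.
      rhs-differ : ∀ m a b z →
        rhs m (p * a) (p̄ * b) (f₁ * z) + rhs m (p̄ * a) (p * b) (f₂ * z) - (t + t) * a ≐ rhs (suc m) a b z
      rhs-differ m a b z = pointwise λ k → trans (solve 8 (λ M t g a b z m e →
          (M :* ((con ½ :+ con ½ :* g) :* a :+ (con ½ :- con ½ :* g) :* b) :- (t :+ t) :* (((con ½ :+ con ½ :* g) :* a) :* m)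
            :+ M :* (t :* t :* (((con ½ :* (con 1ℚ :+ con (+ 3 / 1) :* g :+ con (+ 6 / 1) :* (g :* g))) :* z) :* e))) :+
          (M :* ((con ½ :- con ½ :* g) :* a :+ (con ½ :+ con ½ :* g) :* b) :- (t :+ t) :* (((con ½ :- con ½ :* g) :* a) :* m)
            :+ M :* (t :* t :* (((con ½ :* (con 1ℚ :- con (+ 3 / 1) :* g :+ con (+ 4 / 1) :* (g :* g))) :* z) :* e))) :- (t :+ t) :* a
          := M :* (a :+ b) :- (t :+ t) :* (a :* (con 1ℚ :+ m)) :+ M :* (t :* t :* (z :* ((con 1ℚ :+ con (+ 5 / 1) :* (g :* g)) :* e)))) refl
          (+ M / 1) (seq t k) (seq γ k) (seq a k) (seq b k) (seq z k) (+ m / 1) (seq (G ^ m) k))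
        (cong (λ y → (+ M / 1) ℚ.* (seq a k ℚ.+ seq b k) ℚ.- (seq t k ℚ.+ seq t k) ℚ.* (seq a k ℚ.* y) ℚ.+ (+ M / 1) ℚ.* (seq t k ℚ.* seq t k ℚ.* (seq z k ℚ.* seq (G ^ suc m) k)))
          (sym (+1/1 m)))

      lhs-∑ : ∀ {X : Set} (xs : List X) (d s s′ w : X → ℝ) a b →
        lhs a b (∑ xs λ x → d x * s x) (∑ xs λ x → d x * s′ x) (∑ xs λ x → d x * w x) ≐
        ∑ xs (λ x → d x * lhs a b (s x) (s′ x) (w x))
      lhs-∑ [] d s s′ w a b = pointwise λ k → solve 4 (λ M t a b →
        M :* (a :* con 0ℚ :+ b :* con 0ℚ) :- (t :+ t) :* (a :* con 0ℚ) := con 0ℚ) refl (+ M / 1) (seq t k) (seq a k) (seq b k)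
      lhs-∑ (x ∷ xs) d s s′ w a b = pointwise λ k → trans (solve 11 (λ M t a b d s s′ w S S′ W →
          M :* (a :* (d :* s :+ S) :+ b :* (d :* s′ :+ S′)) :- (t :+ t) :* (a :* (d :* w :+ W))
          := d :* (M :* (a :* s :+ b :* s′) :- (t :+ t) :* (a :* w)) :+ (M :* (a :* S :+ b :* S′) :- (t :+ t) :* (a :* W))) refl
          (+ M / 1) (seq t k) (seq a k) (seq b k) (seq (d x) k) (seq (s x) k) (seq (s′ x) k) (seq (w x) k)
          (seq (∑ xs λ x → d x * s x) k) (seq (∑ xs λ x → d x * s′ x) k) (seq (∑ xs λ x → d x * w x) k))
        (cong (seq (d x) k ℚ.* seq (lhs a b (s x) (s′ x) (w x)) k ℚ.+_) (at (lhs-∑ xs d s s′ w a b) k))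

      leaf₁ : ∀ {m a b z s′} → m ℕ.≤ M → Weights a b z → s′ ≼ 1ℝ → lhs a b 0ℝ s′ 0ℝ ≼ rhs m a b z
      leaf₁ {m} {a} {b} {z} {s′} m≤M (weights ha hb hz _) hs = ≼-by
        (fromℕ M * (b * (1ℝ - s′)) + a * (fromℕ M - fromℕ m) + (a * fromℕ m) * (1ℝ - (t + t)) + fromℕ M * (t * t * (z * G ^ m)))
        (0≼+ (0≼+ (0≼+ (0≼* (0≼fromℕ M) (0≼* hb (≼⇒0≼- hs))) (0≼* ha (≼⇒0≼- (fromℚ-mono (fromℕ-mono m≤M)))))
          (0≼* (0≼* ha (0≼fromℕ m)) (≼⇒0≼- t+t≼1))) (0≼* (0≼fromℕ M) (0≼* (0≼x*x t) (0≼* hz (0≼G^ m)))))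
        (pointwise λ k → solve 8 (λ M t a b z m e s′ →
          M :* (a :+ b) :- (t :+ t) :* (a :* m) :+ M :* (t :* t :* (z :* e))
          := (M :* (a :* con 0ℚ :+ b :* s′) :- (t :+ t) :* (a :* con 0ℚ))
          :+ (M :* (b :* (con 1ℚ :- s′)) :+ a :* (M :- m) :+ (a :* m) :* (con 1ℚ :- (t :+ t)) :+ M :* (t :* t :* (z :* e)))) refl
          (+ M / 1) (seq t k) (seq a k) (seq b k) (seq z k) (+ m / 1) (seq (G ^ m) k) (seq s′ k))

      leaf₂ : ∀ {m a b z s} → m ℕ.≤ M → Weights a b z → s ≼ 1ℝ → lhs a b s 0ℝ 0ℝ ≼ rhs m a b z
      leaf₂ {m} {a} {b} {z} {s} m≤M W@(weights ha hb hz _) hs = ≼-by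
        (fromℕ M * (a * (1ℝ - s)) + fromℕ M * (b + t * t * z - (t + t) * a) + ((t + t) * a) * (fromℕ M - fromℕ m) + fromℕ M * (t * t * z * (G ^ m - 1ℝ)))
        (0≼+ (0≼+ (0≼+ (0≼* (0≼fromℕ M) (0≼* ha (≼⇒0≼- hs))) (0≼* (0≼fromℕ M) (≼⇒0≼- (amgm W))))
          (0≼* (0≼* (0≼+ 0≼t 0≼t) ha) (≼⇒0≼- (fromℚ-mono (fromℕ-mono m≤M))))) (0≼* (0≼fromℕ M) (0≼* (0≼* (0≼x*x t) hz) (≼⇒0≼- (1≼G^ m)))))
        (pointwise λ k → solve 8 (λ M t a b z m e s →
          M :* (a :+ b) :- (t :+ t) :* (a :* m) :+ M :* (t :* t :* (z :* e))
          := (M :* (a :* s :+ b :* con 0ℚ) :- (t :+ t) :* (a :* con 0ℚ))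
          :+ (M :* (a :* (con 1ℚ :- s)) :+ M :* (b :+ t :* t :* z :- (t :+ t) :* a) :+ ((t :+ t) :* a) :* (M :- m) :+ M :* (t :* t :* z :* (e :- con 1ℚ)))) refl
          (+ M / 1) (seq t k) (seq a k) (seq b k) (seq z k) (+ m / 1) (seq (G ^ m) k) (seq s k))

      -- At allowance 0 the term -2tam has vanished, so the trivial bounds on success suffice: long
      -- transcripts are simply given up.
      exhausted : ∀ {a b z s s′ w} → Weights a b z → s ≼ 1ℝ → s′ ≼ 1ℝ → 0ℝ ≼ w → lhs a b s s′ w ≼ rhs 0 a b z
      exhausted {a} {b} {z} {s} {s′} {w} (weights ha hb hz _) hs hs′ hw = ≼-by
        (fromℕ M * (a * (1ℝ - s) + b * (1ℝ - s′)) + (t + t) * (a * w) + fromℕ M * (t * t * (z * 1ℝ)))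
        (0≼+ (0≼+ (0≼* (0≼fromℕ M) (0≼+ (0≼* ha (≼⇒0≼- hs)) (0≼* hb (≼⇒0≼- hs′)))) (0≼* (0≼+ 0≼t 0≼t) (0≼* ha hw)))
          (0≼* (0≼fromℕ M) (0≼* (0≼x*x t) (0≼* hz 0≼1))))
        (pointwise λ k → solve 8 (λ M t a b z s s′ w →
          M :* (a :+ b) :- (t :+ t) :* (a :* con 0ℚ) :+ M :* (t :* t :* (z :* con 1ℚ))
          := (M :* (a :* s :+ b :* s′) :- (t :+ t) :* (a :* w))
          :+ (M :* (a :* (con 1ℚ :- s) :+ b :* (con 1ℚ :- s′)) :+ (t :+ t) :* (a :* w) :+ M :* (t :* t :* (z :* con 1ℚ)))) refl
          (+ M / 1) (seq t k) (seq a k) (seq b k) (seq z k) (seq s k) (seq s′ k) (seq w k))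


      query-same : ∀ {m a b z ch} (s s′ w : Bool → ℝ) c → 0ℝ ≼ ch → Weights a b z →
        (∀ β {a b z} → Weights a b z → lhs a b (s β) (s′ β) (w β) ≼ rhs m a b z) →
        lhs a b (mix c s) (mix c s′) (ch + mix c w) ≼ rhs m a b z
      query-same {m} {a} {b} {z} {ch} s s′ w c hch W ih =
        lhs a b (mix c s) (mix c s′) (ch + mix c w)
          ≼⟨ lhs-same a b (s c) (s (not c)) (s′ c) (s′ (not c)) (w c) (w (not c)) ch (Weights.0≼a W) hch ⟩
        lhs (p * a) (p * b) (s c) (s′ c) (w c) + lhs (p̄ * a) (p̄ * b) (s (not c)) (s′ (not c)) (w (not c))
          ≼⟨ +-mono-≼ (ih c (scale 0≼p 0≼p 0≼p ≼-refl W)) (ih (not c) (scale 0≼p̄ 0≼p̄ 0≼p̄ ≼-refl W)) ⟩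
        rhs m (p * a) (p * b) (p * z) + rhs m (p̄ * a) (p̄ * b) (p̄ * z)
          ≐⟨ rhs-same m a b z ⟩
        rhs m a b z ■

      query-differ : ∀ {m a b z ch} (s s′ w : Bool → ℝ) c → 1ℝ ≼ ch → Weights a b z →
        (∀ β {a b z} → Weights a b z → lhs a b (s β) (s′ β) (w β) ≼ rhs m a b z) →
        lhs a b (mix c s) (p * s′ (not c) + p̄ * s′ c) (ch + mix c w) ≼ rhs (suc m) a b z
      query-differ {m} {a} {b} {z} {ch} s s′ w c hch W ih =
        lhs a b (mix c s) (p * s′ (not c) + p̄ * s′ c) (ch + mix c w)
          ≼⟨ lhs-differ a b (s c) (s (not c)) (s′ c) (s′ (not c)) (w c) (w (not c)) ch (Weights.0≼a W) hch ⟩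
        lhs (p * a) (p̄ * b) (s c) (s′ c) (w c) + lhs (p̄ * a) (p * b) (s (not c)) (s′ (not c)) (w (not c)) - (t + t) * a
          ≼⟨ +-mono-≼ (+-mono-≼ (ih c (scale 0≼p 0≼p̄ 0≼f₁ p²≼p̄f₁ W)) (ih (not c) (scale 0≼p̄ 0≼p 0≼f₂ p̄²≼pf₂ W))) ≼-refl ⟩
        rhs m (p * a) (p̄ * b) (f₁ * z) + rhs m (p̄ * a) (p * b) (f₂ * z) - (t + t) * a
          ≐⟨ rhs-differ m a b z ⟩
        rhs (suc m) a b z ■

      query-step : ∀ {m a b z ch} (s s′ w : Bool → ℝ) c c′ → m ℕ.≤ M → 0ℝ ≼ ch → c ≡ c′ ⊎ 1ℝ ≼ ch →
        (∀ β → s β ≼ 1ℝ) → (∀ β → s′ β ≼ 1ℝ) → (∀ β → 0ℝ ≼ w β) → Weights a b z →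
        (∀ m → m ℕ.≤ M → ∀ β {a b z} → Weights a b z → lhs a b (s β) (s′ β) (w β) ≼ rhs m a b z) →
        lhs a b (mix c s) (mix c′ s′) (ch + mix c w) ≼ rhs m a b z
      query-step {m} {a} {b} {z} {ch} s s′ w c .c m≤M hch (inj₁ refl) hs hs′ hw W ih = query-same {m} {a} {b} {z} {ch} s s′ w c hch W (ih m m≤M)
      -- A comparison can be charged although both orders give the same answer; the allowance is
      -- then left alone.
      query-step {m} {a} {b} {z} {ch} s s′ w true  true  m≤M hch (inj₂ _) hs hs′ hw W ih = query-same {m} {a} {b} {z} {ch} s s′ w true hch W (ih m m≤M)
      query-step {m} {a} {b} {z} {ch} s s′ w false false m≤M hch (inj₂ _) hs hs′ hw W ih = query-same {m} {a} {b} {z} {ch} s s′ w false hch W (ih m m≤M)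
      query-step {zero} {a} {b} {z} {ch} s s′ w true  false m≤M hch (inj₂ _) hs hs′ hw W ih =
        exhausted {a} {b} {z} W (mix-≼ true {s} hs) (mix-≼ false {s′} hs′) (0≼+ hch (0≼mix true {w} hw))
      query-step {zero} {a} {b} {z} {ch} s s′ w false true  m≤M hch (inj₂ _) hs hs′ hw W ih =
        exhausted {a} {b} {z} W (mix-≼ false {s} hs) (mix-≼ true {s′} hs′) (0≼+ hch (0≼mix false {w} hw))
      query-step {suc m} {a} {b} {z} {ch} s s′ w true  false m≤M hch (inj₂ 1≼ch) hs hs′ hw W ih =
        query-differ {m} {a} {b} {z} {ch} s s′ w true 1≼ch W (ih m (ℕₚ.<⇒≤ m≤M))
      query-step {suc m} {a} {b} {z} {ch} s s′ w false true  m≤M hch (inj₂ 1≼ch) hs hs′ hw W ih =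
        query-differ {m} {a} {b} {z} {ch} s s′ w false 1≼ch W (ih m (ℕₚ.<⇒≤ m≤M))

    -- The induction is over all weights at once, so that the likelihood of an answer can be moved
    -- into the weights of its subtree. The allowance m is separate from the query budget q: it
    -- falls only at queries on which the orders differ.
    changeOfMeasure : ∀ {q} (A : Alg n q) m → m ℕ.≤ M → ∀ {a b z} → Weights a b z →
      lhs a b (successOn γ π A) (successOn γ π′ A) (expectedCost A) ≼ rhs m a b z
    changeOfMeasure (output i) m m≤M {a} {b} {z} W = go (separated i)
      where
      correct : Order n → ℝ
      correct ρ = if does (isMin? ρ i) then 1ℝ else 0ℝ
      incorrect : ∀ ρ → ¬ IsMin ρ i → correct ρ ≡ 0ℝ
      incorrect ρ h = cong (λ c → if c then 1ℝ else 0ℝ) (dec-false (isMin? ρ i) h)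
      go : ¬ IsMin π i ⊎ ¬ IsMin π′ i → lhs a b (correct π) (correct π′) 0ℝ ≼ rhs m a b z
      go (inj₁ h) = subst (λ s → lhs a b s (correct π′) 0ℝ ≼ rhs m a b z)
        (sym (incorrect π h)) (leaf₁ {m} {a} {b} {z} m≤M W (indicator≼1 (does (isMin? π′ i))))
      go (inj₂ h) = subst (λ s′ → lhs a b (correct π) s′ 0ℝ ≼ rhs m a b z)
        (sym (incorrect π′ h)) (leaf₂ {m} {a} {b} {z} m≤M W (indicator≼1 (does (isMin? π i))))
    changeOfMeasure (query i j _ next) m m≤M {a} {b} {z} W =
      query-step {m} {a} {b} {z} {charge i j} (λ β → successOn γ π (next β)) (λ β → successOn γ π′ (next β)) (λ β → expectedCost (next β))
        (does (precedes? π i j)) (does (precedes? π′ i j)) m≤M (0≼charge i j) (distinguish i j)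
        (λ β → success≼1 π (next β)) (λ β → success≼1 π′ (next β)) (λ β → 0≼expectedCost (next β)) W
        (λ m m≤M β {a} {b} {z} W → changeOfMeasure (next β) m m≤M {a} {b} {z} W)
    -- Random choices have the same law under both orders, so the weights stay unscaled and the
    -- bounds for the subtrees are averaged.
    changeOfMeasure (random {k = k} D next) m m≤M {a} {b} {z} W = ≼-trans
      (≐⇒≼ (lhs-∑ (allFin k) (prob D) (λ i → successOn γ π (next i)) (λ i → successOn γ π′ (next i)) (λ i → expectedCost (next i)) a b))
      (expectation-≼ D λ i → changeOfMeasure (next i) m m≤M {a} {b} {z} W)

-- Averaging over orders and ranks

∑-allFin-suc : ∀ {n} (f : Fin (suc n) → ℝ) → ∑ (allFin (suc n)) f ≐ f zero + ∑ (allFin n) (λ k → f (suc k))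
∑-allFin-suc {n} f = +-cong ≐-refl (≐-trans (∑-tabulate n suc f) (≐-sym (∑-tabulate n _ _)))

δ : ∀ {n} → Fin n → Fin n → ℝ
δ k r = if does (k Fin.≟ r) then 1ℝ else 0ℝ

0≼δ : ∀ {n} (k r : Fin n) → 0ℝ ≼ δ k r
0≼δ k r = go (does (k Fin.≟ r))
  where
  go : ∀ c → 0ℝ ≼ (if c then 1ℝ else 0ℝ)
  go true  = 0≼1
  go false = ≼-refl

1≼δ : ∀ {n} {k r : Fin n} → k ≡ r → 1ℝ ≼ δ k r
1≼δ {k = k} {r} eq = subst (λ c → 1ℝ ≼ (if c then 1ℝ else 0ℝ)) (sym (dec-true (k Fin.≟ r) eq)) ≼-refl

∑δ≼1 : ∀ {n} (r : Fin n) → ∑ (allFin n) (λ k → δ k r) ≼ 1ℝ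
∑δ≼1 {suc n} zero    =
  ∑ (allFin (suc n)) (λ k → δ k zero)         ≐⟨ ∑-allFin-suc {n} (λ k → δ k zero) ⟩
  1ℝ + ∑ (allFin n) (λ _ → 0ℝ)                ≐⟨ +-cong ≐-refl (∑-zero (allFin n)) ⟩
  1ℝ + 0ℝ                                     ≐⟨ pointwise (λ _ → refl) ⟩
  1ℝ                                          ■
∑δ≼1 {suc n} (suc r) =
  ∑ (allFin (suc n)) (λ k → δ k (suc r))      ≐⟨ ∑-allFin-suc {n} (λ k → δ k (suc r)) ⟩
  0ℝ + ∑ (allFin n) (λ k → δ k r)             ≼⟨ +-mono-≼ ≼-refl (∑δ≼1 r) ⟩
  0ℝ + 1ℝ                                     ≐⟨ pointwise (λ _ → refl) ⟩
  1ℝ                                          ■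

∑δ-suc≼1 : ∀ {n} (r : Fin (suc n)) → ∑ (allFin n) (λ k → δ (suc k) r) ≼ 1ℝ
∑δ-suc≼1 {n} r = ≼-trans (≼-by (δ zero r) (0≼δ zero r)
    (≐-trans (∑-allFin-suc {n} (λ k → δ k r)) (pointwise λ k → ℚₚ.+-comm (seq (δ zero r) k) (seq (∑ (allFin n) λ k → δ (suc k) r) k))))
  (∑δ≼1 r)

charge : ∀ {n} → Order n → Fin n → Fin n → Fin n → ℝ
charge π k i j = δ k (π ⟨$⟩ʳ i) + δ k (π ⟨$⟩ʳ j)

0≼charge : ∀ {n} (π : Order n) k i j → 0ℝ ≼ charge π k i j
0≼charge π k i j = 0≼+ (0≼δ k (π ⟨$⟩ʳ i)) (0≼δ k (π ⟨$⟩ʳ j))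

moveToFront-distinguish : ∀ {n} (π : Order (suc n)) k i j →
  does (precedes? π i j) ≡ does (precedes? (π ∘ₚ moveToFront k) i j) ⊎ 1ℝ ≼ charge π k i j
moveToFront-distinguish π k i j = go (k Fin.≟ π ⟨$⟩ʳ i) (k Fin.≟ π ⟨$⟩ʳ j)
  where
  go : Dec (k ≡ π ⟨$⟩ʳ i) → Dec (k ≡ π ⟨$⟩ʳ j) →
       does (precedes? π i j) ≡ does (precedes? (π ∘ₚ moveToFront k) i j) ⊎ 1ℝ ≼ charge π k i j
  go (yes eq) _ = inj₂ (≼-trans (≐⇒≼ (pointwise λ _ → refl)) (+-mono-≼ (1≼δ eq) (0≼δ k (π ⟨$⟩ʳ j))))
  go _ (yes eq) = inj₂ (≼-trans (≐⇒≼ (pointwise λ _ → refl)) (+-mono-≼ (0≼δ k (π ⟨$⟩ʳ i)) (1≼δ eq)))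
  go (no k≢i) (no k≢j) = inj₁ (moveToFront-answer π k i j k≢i k≢j)

module Bound (γ : ℝ) (0≼γ : 0ℝ ≼ γ) (γ≼¼ : γ ≼ fromℚ (+ 1 / 4)) where

  open Noise γ 0≼γ γ≼¼

  comparisons : ∀ {n q} → Order n → Fin n → Alg n q → ℝ
  comparisons π k = Cost.expectedCost π (charge π k) (0≼charge π k)

  ∑-comparisons : ∀ {n q} (π : Order (suc n)) (A : Alg (suc n) q) →
                  ∑ (allFin n) (λ k → comparisons π (suc k) A) ≼ fromℕ 2 * fromℕ q
  ∑-comparisons {n} {q} π (output i) = ≼-trans (≐⇒≼ (∑-zero (allFin n))) (0≼* (0≼fromℕ 2) (0≼fromℕ q))
  ∑-comparisons {n} {suc q} π (query i j _ next) =
    ∑ F (λ k → charge π (suc k) i j + (p * w k c + p̄ * w k (not c)))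
      ≐⟨ ∑-+ F _ _ ⟩
    ∑ F (λ k → charge π (suc k) i j) + ∑ F (λ k → p * w k c + p̄ * w k (not c))
      ≐⟨ +-cong (∑-+ F _ _) (≐-trans (∑-+ F _ _) (+-cong (∑-*ˡ F p _) (∑-*ˡ F p̄ _))) ⟩
    ∑ F (λ k → δ (suc k) (π ⟨$⟩ʳ i)) + ∑ F (λ k → δ (suc k) (π ⟨$⟩ʳ j)) + mix c (λ β → ∑ F (λ k → w k β))
      ≼⟨ +-mono-≼ (+-mono-≼ (∑δ-suc≼1 (π ⟨$⟩ʳ i)) (∑δ-suc≼1 (π ⟨$⟩ʳ j))) (mix-≼ c λ β → ∑-comparisons π (next β)) ⟩
    1ℝ + 1ℝ + fromℕ 2 * fromℕ q
      ≐⟨ pointwise (λ k → solve 1 (λ q → con 1ℚ :+ con 1ℚ :+ con (+ 2 / 1) :* q := con (+ 2 / 1) :* (con 1ℚ :+ q)) refl (+ q / 1)) ⟩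
    fromℕ 2 * (1ℝ + fromℕ q)
      ≐⟨ *-cong ≐-refl (≐-sym (fromℕ-suc q)) ⟩
    fromℕ 2 * fromℕ (suc q) ■
    where
    F = allFin n
    c = does (precedes? π i j)
    w : Fin n → Bool → ℝ
    w k β = comparisons π (suc k) (next β)
  ∑-comparisons {n} {q} π (random {k = k} D next) =
    ∑ (allFin n) (λ r → ∑ (allFin k) (λ i → prob D i * comparisons π (suc r) (next i)))
      ≐⟨ ∑-swap (allFin n) (allFin k) _ ⟩
    ∑ (allFin k) (λ i → ∑ (allFin n) (λ r → prob D i * comparisons π (suc r) (next i)))
      ≐⟨ ∑-cong (allFin k) (λ i → ∑-*ˡ (allFin n) (prob D i) _) ⟩
    expectation D (λ i → ∑ (allFin n) (λ r → comparisons π (suc r) (next i)))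
      ≼⟨ expectation-≼ D (λ i → ∑-comparisons π (next i)) ⟩
    fromℕ 2 * fromℕ q ■

  module _ {n q : ℕ} (A : Alg (suc n) q) (M : ℕ) (t : ℝ) (0≼t : 0ℝ ≼ t) (t+t≼1 : t + t ≼ 1ℝ) (tE≼½ : t * G ^ M ≼ fromℚ ½) where

    private
      O = orders (suc n)
      s : Order (suc n) → ℝ
      s π = successOn γ π A
      S = ∑ O s
      K = fromℕ M * (fromℕ 2 - fromℚ (+ 3 / 2) * t)

    -- At the root all weights are 1 and m = M, so `rhs` is M(2 - 2t + t²Gᴹ); as tGᴹ ≤ ½, the last
    -- term is at most t/2, leaving 2 - (3/2)t.
    success-pair-≼ : ∀ π k → fromℕ M * (s π + s (π ∘ₚ moveToFront (suc k))) ≼ K + (t + t) * comparisons π (suc k) A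
    success-pair-≼ π k = 0≼-⇒≼ (≼-trans
      (0≼+ (≼⇒0≼- (changeOfMeasure A M ℕₚ.≤-refl {1ℝ} {1ℝ} {1ℝ} (weights 0≼1 0≼1 0≼1 ≼-refl)))
           (0≼* (0≼* (0≼fromℕ M) 0≼t) (≼⇒0≼- tE≼½)))
      (≐⇒≼ (pointwise λ i → solve 6 (λ M t e s s′ w →
          ((M :* (con 1ℚ :+ con 1ℚ) :- (t :+ t) :* (con 1ℚ :* M) :+ M :* (t :* t :* (con 1ℚ :* e)))
            :- (M :* (con 1ℚ :* s :+ con 1ℚ :* s′) :- (t :+ t) :* (con 1ℚ :* w)))
          :+ M :* t :* (con ½ :- t :* e)
          := (M :* (con (+ 2 / 1) :- con (+ 3 / 2) :* t) :+ (t :+ t) :* w) :- M :* (s :+ s′)) refl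
          (+ M / 1) (seq t i) (seq (G ^ M) i) (seq (s π) i) (seq (s (π ∘ₚ moveToFront (suc k))) i) (seq (comparisons π (suc k) A) i))))
      where
      open ChangeOfMeasure π (π ∘ₚ moveToFront (suc k)) (charge π (suc k)) (0≼charge π (suc k))
        (moveToFront-distinguish π (suc k)) (moveToFront-min π k) M t 0≼t t+t≼1

    -- The double sum is evaluated in both orders of summation: over orders first, each rank
    -- contributes `S + S`; over ranks first, the comparison counts within one order total at most
    -- 2q.
    success-sum-≼ : fromℕ n * (fromℕ M * (S + S)) ≼ fromℕ n * (fromℕ (suc n !) * K) + (t + t) * (fromℕ (suc n !) * (fromℕ 2 * fromℕ q))
    success-sum-≼ =
      fromℕ n * (fromℕ M * (S + S))
        ≐⟨ *-cong (pointwise λ _ → cong (λ l → + l / 1) (sym (length-tabulate {n = n} (λ i → i)))) ≐-refl ⟩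
      fromℕ (length F) * (fromℕ M * (S + S))
        ≐⟨ ≐-sym (∑-const F _) ⟩
      ∑ F (λ k → fromℕ M * (S + S))
        ≐⟨ ∑-cong F (λ k → *-cong ≐-refl (≐-trans (+-cong ≐-refl (≐-sym (∑-orders-∘ₚ (suc n) s (successOn-cong γ A) (moveToFront (suc k)))))
             (≐-sym (∑-+ O _ _)))) ⟩
      ∑ F (λ k → fromℕ M * ∑ O (λ π → s π + s (π ∘ₚ moveToFront (suc k))))
        ≐⟨ ∑-cong F (λ k → ≐-sym (∑-*ˡ O (fromℕ M) _)) ⟩
      ∑ F (λ k → ∑ O (λ π → fromℕ M * (s π + s (π ∘ₚ moveToFront (suc k)))))
        ≼⟨ ∑-mono F (λ k → ∑-mono O (λ π → success-pair-≼ π k)) ⟩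
      ∑ F (λ k → ∑ O (λ π → K + (t + t) * comparisons π (suc k) A))
        ≐⟨ ∑-cong F (λ k → ≐-trans (∑-+ O _ _) (+-cong (∑-orders-const K) (∑-*ˡ O (t + t) _))) ⟩
      ∑ F (λ k → fromℕ (suc n !) * K + (t + t) * ∑ O (λ π → comparisons π (suc k) A))
        ≐⟨ ≐-trans (∑-+ F _ _) (+-cong (≐-trans (∑-const F _) (*-cong (pointwise λ _ → cong (λ l → + l / 1) (length-tabulate {n = n} (λ i → i))) ≐-refl)) (∑-*ˡ F (t + t) _)) ⟩
      fromℕ n * (fromℕ (suc n !) * K) + (t + t) * ∑ F (λ k → ∑ O (λ π → comparisons π (suc k) A))
        ≐⟨ +-cong ≐-refl (*-cong ≐-refl (∑-swap F O _)) ⟩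
      fromℕ n * (fromℕ (suc n !) * K) + (t + t) * ∑ O (λ π → ∑ F (λ k → comparisons π (suc k) A))
        ≼⟨ +-mono-≼ ≼-refl (*-monoˡ-≼ (t + t) (0≼+ 0≼t 0≼t) (≼-trans (∑-mono O λ π → ∑-comparisons π A) (≐⇒≼ (∑-orders-const _)))) ⟩
      fromℕ n * (fromℕ (suc n !) * K) + (t + t) * (fromℕ (suc n !) * (fromℕ 2 * fromℕ q)) ■
      where
      F = allFin n
      ∑-orders-const : ∀ c → ∑ O (λ _ → c) ≐ fromℕ (suc n !) * c
      ∑-orders-const c = ≐-trans (∑-const O c) (*-cong (pointwise λ _ → cong (λ l → + l / 1) (length-orders (suc n))) ≐-refl)

  -- The choice of allowance makes the comparison count average at most a quarter of it. This
  -- returns t/2 to the pair bound 2 - (3/2)t, so a pair succeeds with total probability at most 2 -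
  -- t on average.
  success≼1-½t : ∀ {n q} (A : Alg (suc (suc n)) q) M → 8 ℕ.* q ℕ.≤ suc M ℕ.* suc n →
    ∀ t → 0ℝ ≼ t → t + t ≼ 1ℝ → t * G ^ suc M ≼ fromℚ ½ →
    successProbability γ A ≼ 1ℝ - fromℚ ½ * t
  success≼1-½t {n} {q} A M 8q≤Mn t 0≼t t+t≼1 tE≼½ =
    r * S                                     ≐⟨ pointwise (λ k → solve 2 (λ r S → r :* S := con ½ :* r :* (S :+ S)) refl (seq r k) (seq S k)) ⟩
    fromℚ ½ * r * (S + S)                     ≼⟨ *-monoˡ-≼ (fromℚ ½ * r) (0≼* 0≼½ 0≼r) 2S≼ ⟩
    fromℚ ½ * r * (L * (fromℕ 2 - t))         ≐⟨ pointwise (λ k → trans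
                                                   (solve 3 (λ r L t → con ½ :* r :* (L :* (con (+ 2 / 1) :- t)) := (L :* r) :* (con 1ℚ :- con ½ :* t)) refl (seq r k) (seq L k) (seq t k))
                                                   (trans (cong (ℚ._* (1ℚ ℚ.- ½ ℚ.* seq t k)) (fromℕ-inverse (suc (suc n) !) {{suc (suc n) ℕₚ.!≢0}}))
                                                     (ℚₚ.*-identityˡ (1ℚ ℚ.- ½ ℚ.* seq t k)))) ⟩
    1ℝ - fromℚ ½ * t                          ■
    where
    S = ∑ (orders (suc (suc n))) (λ π → successOn γ π A)
    L = fromℕ (suc (suc n) !)
    r = fromℚ ((+ 1 / (suc (suc n) !)) {{suc (suc n) ℕₚ.!≢0}})
    0≼r : 0ℝ ≼ r
    0≼r = fromℚ-mono (0≤1/ (suc (suc n) !) {{suc (suc n) ℕₚ.!≢0}})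
    M′ = fromℕ (suc M)
    n′ = fromℕ (suc n)
    8q≼ : fromℕ 8 * fromℕ q ≼ M′ * n′
    8q≼ = ≼-trans (≐⇒≼ (≐-sym (fromℕ-* 8 q))) (≼-trans (fromℚ-mono (fromℕ-mono 8q≤Mn)) (≐⇒≼ (fromℕ-* (suc M) (suc n))))
    2S≼ : S + S ≼ L * (fromℕ 2 - t)
    -- Both factors cancelled are successors, so a small q, for which `M` may be 0, needs no
    -- separate case.
    2S≼ = *-cancelˡ-≼ M (*-cancelˡ-≼ n (
      n′ * (M′ * (S + S))
        ≼⟨ success-sum-≼ A (suc M) t 0≼t t+t≼1 tE≼½ ⟩
      n′ * (L * (M′ * (fromℕ 2 - fromℚ (+ 3 / 2) * t))) + (t + t) * (L * (fromℕ 2 * fromℕ q))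
        ≼⟨ ≼-by (fromℚ ½ * (t * L) * (M′ * n′ - fromℕ 8 * fromℕ q)) (0≼* (0≼* 0≼½ (0≼* 0≼t (0≼fromℕ (suc (suc n) !)))) (≼⇒0≼- 8q≼))
             (pointwise λ k → solve 5 (λ n M L t q → n :* (M :* (L :* (con (+ 2 / 1) :- t)))
               := n :* (L :* (M :* (con (+ 2 / 1) :- con (+ 3 / 2) :* t))) :+ (t :+ t) :* (L :* (con (+ 2 / 1) :* q))
                 :+ con ½ :* (t :* L) :* (M :* n :- con (+ 8 / 1) :* q)) refl
               (seq n′ k) (seq M′ k) (seq L k) (seq t k) (+ q / 1)) ⟩
      n′ * (M′ * (L * (fromℕ 2 - t))) ■))

-- Choice of the constants

module Parameters (c : ℝ) (1≼c : 1ℝ ≼ c) (n : ℕ) (γ : ℝ) (0≼γ : 0ℝ ≼ γ) (γ≼¼ : γ ≼ fromℚ (+ 1 / 4))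
                  (q : ℕ) (qγ²≼cn : fromℕ q * (γ * γ) ≼ c * fromℕ (suc (suc n))) where

  open Noise γ 0≼γ γ≼¼

  -- The allowance actually used is `suc M`, just above 8q/(n + 1), where n + 1 counts the nonzero
  -- ranks of n + 2 elements.
  M : ℕ
  M = 8 ℕ.* q DivMod./ suc n

  8q≤Mn : 8 ℕ.* q ℕ.≤ suc M ℕ.* suc n
  8q≤Mn = begin
    8 ℕ.* q                                              ≡⟨ DivMod.m≡m%n+[m/n]*n (8 ℕ.* q) (suc n) ⟩
    (8 ℕ.* q) DivMod.% suc n ℕ.+ M ℕ.* suc n             ≤⟨ ℕₚ.+-monoˡ-≤ (M ℕ.* suc n) (ℕₚ.<⇒≤ (DivMod.m%n<n (8 ℕ.* q) (suc n))) ⟩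
    suc n ℕ.+ M ℕ.* suc n                                ∎
    where open ℕₚ.≤-Reasoning

  0≼c : 0ℝ ≼ c
  0≼c = ≼-trans 0≼1 1≼c

  γ²≼c : γ * γ ≼ c
  γ²≼c = ≼-trans (*-mono-≼ 0≼γ 0≼1 γ≼1 γ≼1) (≼-trans (≐⇒≼ (pointwise λ _ → refl)) 1≼c)
    where
    γ≼1 : γ ≼ 1ℝ
    γ≼1 = ≼-trans γ≼¼ (fromℚ-mono (ℚₚ.≤ᵇ⇒≤ {+ 1 / 4} {1ℚ} _))

  -- Multiplied by n + 1, the left side is at most (n + 1)γ² + 8qγ² ≤ c(n + 1) + 8c(n + 2), and n +
  -- 2 ≤ 2(n + 1). The 1 in 17 = 1 + 16 is the cost of rounding up.
  Mγ²≼17c : fromℕ (suc M) * (γ * γ) ≼ fromℕ 17 * c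
  Mγ²≼17c = *-cancelˡ-≼ n (
    n′ * (fromℕ (suc M) * (γ * γ))
      ≐⟨ pointwise (λ k → solve 3 (λ n M g → n :* (M :* g) := (M :* n) :* g) refl (seq n′ k) (+ suc M / 1) (seq (γ * γ) k)) ⟩
    fromℕ (suc M) * n′ * (γ * γ)
      ≐⟨ *-cong (≐-sym (fromℕ-* (suc M) (suc n))) ≐-refl ⟩
    fromℕ (suc M ℕ.* suc n) * (γ * γ)
      ≼⟨ *-mono-≼ (0≼fromℕ (suc M ℕ.* suc n)) (0≼x*x γ) (fromℚ-mono (fromℕ-mono (ℕₚ.+-monoʳ-≤ (suc n) (DivMod.m/n*n≤m (8 ℕ.* q) (suc n))))) ≼-refl ⟩
    fromℕ (suc n ℕ.+ 8 ℕ.* q) * (γ * γ)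
      ≐⟨ *-cong (≐-trans (fromℕ-+ (suc n) (8 ℕ.* q)) (+-cong ≐-refl (fromℕ-* 8 q))) ≐-refl ⟩
    (n′ + fromℕ 8 * fromℕ q) * (γ * γ)
      ≼⟨ 0≼-⇒≼ (≼-trans
           (0≼+ (0≼+ (0≼* (0≼fromℕ (suc n)) (≼⇒0≼- γ²≼c)) (0≼* (0≼fromℕ 8) (≼⇒0≼- qγ²≼)))
                (0≼* (0≼* (0≼fromℕ 8) 0≼c) (0≼fromℕ n)))
           (≐⇒≼ (pointwise λ k → trans (solve 5 (λ c n n′ q g →
               n′ :* (c :- g) :+ con (+ 8 / 1) :* (c :* (con 1ℚ :+ n′) :- q :* g) :+ con (+ 8 / 1) :* c :* n
               := n′ :* (con (+ 9 / 1) :* c) :+ con (+ 8 / 1) :* c :* (con 1ℚ :+ n) :- (n′ :+ con (+ 8 / 1) :* q) :* g) refl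
               (seq c k) (+ n / 1) (seq n′ k) (+ q / 1) (seq (γ * γ) k))
             (trans (cong (λ y → seq n′ k ℚ.* ((+ 9 / 1) ℚ.* seq c k) ℚ.+ (+ 8 / 1) ℚ.* seq c k ℚ.* y ℚ.- (seq n′ k ℚ.+ (+ 8 / 1) ℚ.* (+ q / 1)) ℚ.* seq (γ * γ) k) (sym (+1/1 n)))
               (solve 4 (λ c n′ q g → n′ :* (con (+ 9 / 1) :* c) :+ con (+ 8 / 1) :* c :* n′ :- (n′ :+ con (+ 8 / 1) :* q) :* g
                 := n′ :* (con (+ 17 / 1) :* c) :- (n′ :+ con (+ 8 / 1) :* q) :* g) refl (seq c k) (seq n′ k) (+ q / 1) (seq (γ * γ) k)))))) ⟩
    n′ * (fromℕ 17 * c) ■)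
    where
    n′ = fromℕ (suc n)
    qγ²≼ : fromℕ q * (γ * γ) ≼ c * (1ℝ + n′)
    qγ²≼ = ≼-trans qγ²≼cn (≐⇒≼ (*-cong ≐-refl (fromℕ-suc (suc n))))

  -- 85 = 5 · 17, from the growth 5γ² per comparison and `Mγ²≼17c`. The factor ½ secures both 2t ≤ 1
  -- and `tE≼½`.
  t : ℝ
  t = fromℚ ½ * exp (- (fromℕ 85 * c))

  0≼t : 0ℝ ≼ t
  0≼t = 0≼* 0≼½ (exp-nonneg (- (fromℕ 85 * c)))

  t+t≼1 : t + t ≼ 1ℝ
  t+t≼1 = ≼-trans (≐⇒≼ (pointwise λ k → solve 1 (λ e → con ½ :* e :+ con ½ :* e := e) refl (seq (exp (- (fromℕ 85 * c))) k)))
    (exp-neg≼1 (0≼* (0≼fromℕ 85) 0≼c))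

  tE≼½ : t * G ^ suc M ≼ fromℚ ½
  tE≼½ =
    fromℚ ½ * exp (- u) * G ^ suc M          ≐⟨ pointwise (λ k → ℚₚ.*-assoc ½ (seq (exp (- u)) k) (seq (G ^ suc M) k)) ⟩
    fromℚ ½ * (exp (- u) * G ^ suc M)        ≼⟨ *-monoˡ-≼ (fromℚ ½) 0≼½ (
      exp (- u) * G ^ suc M                    ≼⟨ *-monoˡ-≼ (exp (- u)) (exp-nonneg (- u)) ([1+x]^m≼exp 0≼growth (suc M)) ⟩
      exp (- u) * exp v                        ≼⟨ exp-*-≼ (- u) v ⟩
      exp (- u + v)                            ≐⟨ exp-cong (pointwise λ k → solve 2 (λ u v → (:- u) :+ v := :- (u :- v)) refl (seq u k) (seq v k)) ⟩
      exp (- (u - v))                          ≼⟨ exp-neg≼1 0≼u-v ⟩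
      1ℝ                                       ■) ⟩
    fromℚ ½ * 1ℝ                             ≐⟨ pointwise (λ _ → refl) ⟩
    fromℚ ½                                  ■
    where
    u = fromℕ 85 * c
    v = fromℕ (suc M) * growth
    0≼u-v : 0ℝ ≼ u - v
    0≼u-v = ≼-trans (0≼* (0≼fromℕ 5) (≼⇒0≼- Mγ²≼17c))
      (≐⇒≼ (pointwise λ k → solve 3 (λ c M g → con (+ 5 / 1) :* (con (+ 17 / 1) :* c :- M :* g) := con (+ 85 / 1) :* c :- M :* (con (+ 5 / 1) :* g))
        refl (seq c k) (+ suc M / 1) (seq (γ * γ) k)))

  -- One factor ½ comes from `t`, the other from the failure bound t/2. The 2 in 87 = 85 + 2 absorbs
  -- them: c ≥ 1 gives exp c ≥ 1 + c ≥ 2, so exp (-2c) ≤ ¼.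
  exp≼½t : exp (- (fromℕ 87 * c)) ≼ fromℚ ½ * t
  exp≼½t =
    exp (- (fromℕ 87 * c))                       ≐⟨ exp-cong (pointwise λ k → solve 1 (λ c → :- (con (+ 87 / 1) :* c) := :- (con (+ 85 / 1) :* c) :+ :- (c :+ c)) refl (seq c k)) ⟩
    exp (- u + - (c + c))                        ≼⟨ exp-+-≼ (- u) (- (c + c)) ⟩
    exp (- u) * exp (- (c + c))                  ≼⟨ *-monoˡ-≼ (exp (- u)) (exp-nonneg (- u)) e^-2c≼¼ ⟩
    exp (- u) * fromℚ (+ 1 / 4)                  ≐⟨ pointwise (λ k → solve 1 (λ e → e :* con (+ 1 / 4) := con ½ :* (con ½ :* e)) refl (seq (exp (- u)) k)) ⟩
    fromℚ ½ * t                                  ■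
    where
    u = fromℕ 85 * c
    2≼exp : fromℕ 2 ≼ exp c
    2≼exp = ≼-trans (≼-trans (≐⇒≼ (pointwise λ _ → refl)) (+-mono-≼ (≼-refl {1ℝ}) 1≼c)) (1+x≼exp 0≼c)
    e^-2c≼¼ : exp (- (c + c)) ≼ fromℚ (+ 1 / 4)
    e^-2c≼¼ = *-cancelˡ-≼ 3 (
      fromℕ 4 * exp (- (c + c))                    ≐⟨ pointwise (λ k → ℚₚ.*-comm (+ 4 / 1) (seq (exp (- (c + c))) k)) ⟩
      exp (- (c + c)) * fromℕ 4                    ≼⟨ *-monoˡ-≼ (exp (- (c + c))) (exp-nonneg (- (c + c))) (
        fromℕ 4                                      ≐⟨ pointwise (λ _ → refl) ⟩
        fromℕ 2 * fromℕ 2                            ≼⟨ *-mono-≼ (0≼fromℕ 2) (exp-nonneg c) 2≼exp 2≼exp ⟩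
        exp c * exp c                                ≼⟨ exp-*-≼ c c ⟩
        exp (c + c)                                  ■) ⟩
      exp (- (c + c)) * exp (c + c)                ≼⟨ exp-inverse (c + c) ⟩
      1ℝ                                           ≐⟨ pointwise (λ _ → refl) ⟩
      fromℕ 4 * fromℚ (+ 1 / 4)                    ■)

theorem13 : ∃ λ (C : ℝ) → 0ℝ < C × (∃ λ (N : ℕ) →
    ∀ (c : ℝ) → 1ℝ ≤ c →
    ∀ (n : ℕ) → N ℕ.≤ n →
    ∀ (γ : ℝ) → 0ℝ < γ → γ ≤ fromℚ (+ 1 / 4) →
    ∀ (q : ℕ) → fromℕ q * (γ * γ) ≤ c * fromℕ n →
    ∀ (A : Alg n q) →
    successProbability γ A ≤ 1ℝ - exp (- (C * c)))
-- The threshold 2 excludes n = 1, where the only possible output is always correct.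
theorem13 = fromℕ 87 , (1ℚ , ℚₚ.positive⁻¹ 1ℚ , 0 , λ _ _ → ℚₚ.≤ᵇ⇒≤ {1ℚ} {+ 87 / 1} _) , 2 , main
  where
  main : ∀ (c : ℝ) → 1ℝ ≤ c → ∀ (n : ℕ) → 2 ℕ.≤ n →
    ∀ (γ : ℝ) → 0ℝ < γ → γ ≤ fromℚ (+ 1 / 4) →
    ∀ (q : ℕ) → fromℕ q * (γ * γ) ≤ c * fromℕ n →
    ∀ (A : Alg n q) → successProbability γ A ≤ 1ℝ - exp (- (fromℕ 87 * c))
  main c 1≤c (suc zero) (ℕ.s≤s ())
  main c 1≤c (suc (suc n)) _ γ 0<γ γ≤¼ q budget A = un≼ (
    successProbability γ A              ≼⟨ Bound.success≼1-½t γ 0≼γ (mk≼ γ≤¼) A M 8q≤Mn t 0≼t t+t≼1 tE≼½ ⟩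
    1ℝ - fromℚ ½ * t                    ≼⟨ ≼-by (fromℚ ½ * t - e) (≼⇒0≼- exp≼½t)
                                             (pointwise λ k → solve 2 (λ x e → con 1ℚ :- e := (con 1ℚ :- x) :+ (x :- e)) refl (seq (fromℚ ½ * t) k) (seq e k)) ⟩
    1ℝ - e                              ■)
    where
    0≼γ : 0ℝ ≼ γ
    0≼γ = <⇒≼ 0<γ
    open Parameters c (mk≼ 1≤c) n γ 0≼γ (mk≼ γ≤¼) q (mk≼ budget)
    e = exp (- (fromℕ 87 * c))
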